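{- Let $G$ be a connected graph with a cut-vertex. Then $G$ is $2$-$\gamma_{\rm MB}'$-critical if and only if $G \in \mathcal{F}\cup\mathcal{F}'$.
   Context: All graphs are finite and simple; equality of graphs and membership in a family are meant up to isomorphism. A vertex $x$ of a connected graph $G$ is a cut-vertex if $G-x$ is not connected. A set $D\subseteq V(G)$ is a dominating set of $G$ if every vertex of $V(G)-D$ has a neighbor in $D$. Maker-Breaker domination game (S-game): two players, Dominator and Staller, alternately select a vertex of $G$ that has not been selected before, with Staller moving first. Dominator's goal is that at some point the set of vertices he has selected is a dominating set of $G$; Staller's goal is to prevent this. The game ends when one of the players accomplishes the goal. If Dominator wins the S-game on $G$ under optimal play, then $\gamma_{\rm MB}'(G)$ is the number of moves Dominator makes when both players play optimally (Dominator wants to minimize the number of his moves, Staller wants to maximize it); equivalently, it is the least $k$ such that Dominator has a strategy guaranteeing that he has selected a dominating set after at most $k$ of his moves. If Staller wins, $\gamma_{\rm MB}'(G)=\infty$. A graph $G$ is $2$-$\gamma_{\rm MB}'$-critical if $\gamma_{\rm MB}'(G)=2$ and $\gamma_{\rm MB}'(G-e)>2$ for every $e\in E(G)$, where $G-e$ is obtained from $G$ by deleting the edge $e$ (and $\infty>2$). The join $G\vee H$ is obtained from the disjoint union of $G$ and $H$ by adding all edges $uv$ with $u\in V(G)$, $v\in V(H)$. For $m\ge 2$ let $H_m=K_2\vee \overline{K_{m-2}}$ (so $H_2=K_2$), a graph on $m$ vertices; $H_0$ is the graph with no vertices. Family $\mathcal{F}$: let $t\ge 1$ be an integer and let $m_1\le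 m_2$ be integers with $m_1\in\{0,2,3,4,\ldots\}$ and $m_2\ge 2$; if $m_1=0$, assume in addition $t\ge 2$. Let $\{v_1,v_2\}$ and $B$ be independent sets of vertices, $v_1\neq v_2$, $|B|=t$. The graph $F_{m_1,t,m_2}$ is obtained from the disjoint union of $H_{m_1}$, $H_{m_2}$, $B$ and $\{v_1,v_2\}$ by adding an edge between $v_1$ and each vertex of $H_{m_1}$, an edge between $v_2$ and each vertex of $H_{m_2}$, and all edges between $\{v_1,v_2\}$ and $B$. The family $\mathcal{F}$ consists of all graphs $F_{m_1,t,m_2}$ with such $m_1,t,m_2$. Family $\mathcal{F}'$: let $s,q,m\ge 2$ be integers. Let $P$ be the graph obtained from $K_{2,s}$, where $\{a,b\}$ is a part of size $2$ of its bipartition, by adding $q-2$ isolated vertices $b_1,\ldots,b_{q-2}$. Let $Q=K_1\vee P$. The graph $F'_{s,q,m}$ is obtained from the disjoint union of $Q$ and $H_m$ by adding a new vertex $x$ and joining it by an edge to each vertex in $V(H_m)\cup\{a,b,b_1,\ldots,b_{q-2}\}$. The family $\mathcal{F}'$ consists of all graphs $F'_{s,q,m}$ with $s,q,m\ge 2$. -}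

module Defs where

open import Data.Bool.Base using (Bool; true; false; T; not; _∧_; _∨_)
open import Data.Bool.Properties using (T?; ∨-comm; ∧-comm)
open import Data.Fin.Base using (Fin; zero; suc; punchIn; punchOut)
open import Data.Fin.Properties as Fin
  using (any?; all?; inj⇒≟; +↔⊎; injective⇒≤;
         punchIn-punchOut; punchOut-punchIn; punchOut-cong; punchInᵢ≢i)
open import Data.List.Base using (List; []; _∷_; length; lookup)
open import Data.List.Membership.Propositional using (_∈_; _∉_)
import Data.List.Membership.DecPropositional as DecMembership
open import Data.List.Relation.Unary.All using (All; []; _∷_)
open import Data.List.Relation.Unary.All.Properties using (¬Any⇒All¬)
open import Data.List.Relation.Unary.Unique.Propositional using (Unique)
open import Data.List.Relation.Unary.AllPairs using ([]; _∷_)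
open import Data.Nat.Base using (ℕ; zero; suc; pred; _+_; _∸_; _≤_; _<_; z≤n; s≤s)
import Data.Nat.Properties as ℕ
open import Data.Product.Base using (Σ; ∃; ∃-syntax; _×_; _,_; proj₁; proj₂)
open import Data.Sum.Base using (_⊎_; inj₁; inj₂)
open import Data.Sum.Function.Propositional using (_⊎-↔_)
open import Function.Base using (_∘_; _on_)
open import Function.Bundles using (_↔_; Inverse; mk↔ₛ′)
open import Function.Construct.Composition using (_↔-∘_)
open import Function.Construct.Identity using (↔-id)
open import Function.Construct.Symmetry using (↔-sym)
open import Function.Properties.Inverse using (↔⇒↣)
open import Level using (0ℓ)
open import Relation.Binary.Core using (Rel)
open import Relation.Binary.Construct.Closure.ReflexiveTransitive using (Star)
open import Relation.Binary.Definitions using (DecidableEquality)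
open import Relation.Binary.PropositionalEquality
  using (_≡_; _≢_; refl; sym; trans; cong; cong₂; subst)
open import Relation.Nullary using (¬_; Dec; yes; no; does; contradiction)
open import Relation.Nullary.Decidable
  using (map′; _×-dec_; _⊎-dec_; _→-dec_; ¬?; dec-true; dec-false)
open import Relation.Nullary.Construct.Add.Supremum using (_⁺; ⊤⁺; [_])
open import Relation.Binary.Construct.Add.Supremum.Strict _<_ using (_<⁺_)
open import Relation.Unary using (Pred; Decidable)

record Graph : Set₁ where
  field
    V          : Set
    adj        : V → V → Bool
    adj-sym    : ∀ u v → adj u v ≡ adj v u
    adj-irrefl : ∀ v → adj v v ≡ false
    order      : ℕ
    enum       : V ↔ Fin order

  Adj : Rel V 0ℓ
  Adj u v = T (adj u v)

  _≟_ : DecidableEquality V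
  _≟_ = inj⇒≟ (↔⇒↣ enum)

open Graph using (V)

infix 4 _≅_

record _≅_ (G H : Graph) : Set where
  field
    bijection : V G ↔ V H
    preserves : ∀ u v → Graph.adj G u v ≡
                        Graph.adj H (Inverse.to bijection u) (Inverse.to bijection v)

-- The null graph counts as connected, so the vertex of a one-vertex graph is
-- not a cut-vertex.
Connected : Graph → Set
Connected G = ∀ u v → Star (Graph.Adj G) u v

private
  -- Σ A (_≢ x) has no duplicate elements: ⊥ is definitionally
  -- proof-irrelevant, hence so is _≢ x.
  Σ≢-≡ : ∀ {A : Set} {x : A} {p q : Σ A (_≢ x)} → proj₁ p ≡ proj₁ q → p ≡ q
  Σ≢-≡ refl = refl

  enum-≢ : ∀ {A : Set} {n} → A ↔ Fin n → (x : A) → Σ A (_≢ x) ↔ Fin (pred n)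
  enum-≢ {n = zero}  e x with () ← Inverse.to e x
  enum-≢ {A} {n = suc n} e x = mk↔ₛ′ to′ from′ to∘from from∘to
    where
    open Inverse e using (to; from; strictlyInverseˡ; strictlyInverseʳ)

    to≢ : ∀ {v} → v ≢ x → to x ≢ to v
    to≢ {v} v≢x eq = v≢x (trans (sym (strictlyInverseʳ v))
                         (trans (cong from (sym eq)) (strictlyInverseʳ x)))

    from≢ : ∀ i → from (punchIn (to x) i) ≢ x
    from≢ i eq = punchInᵢ≢i (to x) i (trans (sym (strictlyInverseˡ _)) (cong to eq))

    to′ : Σ A (_≢ x) → Fin n
    to′ (v , v≢x) = punchOut (to≢ v≢x)

    from′ : Fin n → Σ A (_≢ x)
    from′ i = from (punchIn (to x) i) , from≢ i

    to∘from : ∀ i → to′ (from′ i) ≡ i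
    to∘from i = trans (punchOut-cong (to x) (strictlyInverseˡ (punchIn (to x) i)))
                      (punchOut-punchIn (to x))

    from∘to : ∀ p → from′ (to′ p) ≡ p
    from∘to (v , v≢x) = Σ≢-≡ (trans (cong from (punchIn-punchOut (to≢ v≢x)))
                                    (strictlyInverseʳ v))

deleteVertex : (G : Graph) → V G → Graph
deleteVertex G x = record
  { V          = Σ (V G) (_≢ x)
  ; adj        = adj on proj₁
  ; adj-sym    = λ u v → adj-sym (proj₁ u) (proj₁ v)
  ; adj-irrefl = λ v → adj-irrefl (proj₁ v)
  ; order      = pred order
  ; enum       = enum-≢ enum x
  }
  where open Graph G hiding (V)

IsCutVertex : (G : Graph) → V G → Set
IsCutVertex G x = ¬ Connected (deleteVertex G x)

deleteEdge : (G : Graph) → V G → V G → Graph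
deleteEdge G a b = record
  { V          = V G
  ; adj        = λ u v → adj u v ∧ not (isAB u v)
  ; adj-sym    = λ u v → cong₂ (λ p q → p ∧ not q) (adj-sym u v) (isAB-sym u v)
  ; adj-irrefl = λ v → cong (_∧ not (isAB v v)) (adj-irrefl v)
  ; order      = order
  ; enum       = enum
  }
  where
  open Graph G hiding (V)

  isAB : V G → V G → Bool
  isAB u v = does (((u ≟ a) ×-dec (v ≟ b)) ⊎-dec ((u ≟ b) ×-dec (v ≟ a)))

  isAB-sym : ∀ u v → isAB u v ≡ isAB v u
  isAB-sym u v = trans
    (∨-comm (does (u ≟ a) ∧ does (v ≟ b)) (does (u ≟ b) ∧ does (v ≟ a)))
    (cong₂ _∨_ (∧-comm (does (u ≟ b)) _) (∧-comm (does (u ≟ a)) _))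

module Game (G : Graph) where
  open Graph G hiding (V)
  open DecMembership _≟_ using (_∈?_)

  Dominating : Pred (V G) 0ℓ → Set
  Dominating D = ∀ v → ¬ D v → ∃[ u ] D u × Adj u v

  -- A position lists the vertices ds selected by Dominator and ss selected by
  -- Staller.
  Free : List (V G) → List (V G) → Pred (V G) 0ℓ
  Free ds ss v = v ∉ ds × v ∉ ss

  -- With Staller to move, Dominator has a strategy guaranteeing that he has
  -- selected a dominating set after at most k further moves of his.  Requiring
  -- a free vertex for Staller is essential: once every vertex has been
  -- selected without Dominator dominating, Staller has won.
  DominatorWins : ℕ → List (V G) → List (V G) → Set
  DominatorWins zero    ds ss = Dominating (_∈ ds)
  DominatorWins (suc k) ds ss =
    Dominating (_∈ ds) ⊎
    (∃ (Free ds ss) ×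
     (∀ s → Free ds ss s →
      ∃[ d ] Free ds (s ∷ ss) d × DominatorWins k (d ∷ ds) (s ∷ ss)))

  DominatorWinsIn : ℕ → Set
  DominatorWinsIn k = DominatorWins k [] []

  open Inverse enum using (to; from; strictlyInverseʳ)

  ∃? : ∀ {P : Pred (V G) 0ℓ} → Decidable P → Dec (∃ P)
  ∃? {P} P? = map′ (λ (i , p) → from i , p)
                   (λ (v , p) → to v , subst P (sym (strictlyInverseʳ v)) p)
                   (any? (P? ∘ from))

  ∀? : ∀ {P : Pred (V G) 0ℓ} → Decidable P → Dec (∀ v → P v)
  ∀? {P} P? = map′ (λ f v → subst P (strictlyInverseʳ v) (f (to v)))
                   (λ f i → f (from i))
                   (all? (P? ∘ from))

  dominating? : ∀ {D} → Decidable D → Dec (Dominating D)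
  dominating? D? =
    ∀? λ v → ¬? (D? v) →-dec ∃? λ u → D? u ×-dec T? (adj u v)

  free? : ∀ ds ss → Decidable (Free ds ss)
  free? ds ss v = ¬? (v ∈? ds) ×-dec ¬? (v ∈? ss)

  dominatorWins? : ∀ k ds ss → Dec (DominatorWins k ds ss)
  dominatorWins? zero    ds ss = dominating? (_∈? ds)
  dominatorWins? (suc k) ds ss =
    dominating? (_∈? ds) ⊎-dec
    (∃? (free? ds ss) ×-dec
     ∀? λ s → free? ds ss s →-dec
       ∃? λ d → free? ds (s ∷ ss) d ×-dec dominatorWins? k (d ∷ ds) (s ∷ ss))

  -- leastFrom j n is the least k with j ≤ k < j + n and DominatorWinsIn k, and
  -- ∞ if there is none.
  leastFrom : ℕ → ℕ → ℕ ⁺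
  leastFrom j zero    = ⊤⁺
  leastFrom j (suc n) with dominatorWins? j [] []
  ... | yes _ = [ j ]
  ... | no  _ = leastFrom (suc j) n

  -- Dominator makes at most `order` moves, so larger k need not be searched;
  -- see γ′MB-finite and γ′MB-infinite below.
  γ′MB : ℕ ⁺
  γ′MB = leastFrom 0 (suc order)

  private
    unique⇒length≤order : ∀ {vs} → Unique vs → length vs ≤ order
    unique⇒length≤order {vs} uniq =
      injective⇒≤ {f = to ∘ lookup vs} λ {i} {j} eq → lookup-inj uniq i j (to-inj eq)
      where
      to-inj : ∀ {u v} → to u ≡ to v → u ≡ v
      to-inj {u} {v} eq =
        trans (sym (strictlyInverseʳ u)) (trans (cong from eq) (strictlyInverseʳ v))

      lookup≢ : ∀ {x xs} → All (x ≢_) xs → ∀ i → x ≢ lookup xs i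
      lookup≢ (p ∷ ps) zero    = p
      lookup≢ (p ∷ ps) (suc i) = lookup≢ ps i

      lookup-inj : ∀ {xs} → Unique xs → ∀ i j → lookup xs i ≡ lookup xs j → i ≡ j
      lookup-inj (p ∷ ps) zero    zero    eq = refl
      lookup-inj (p ∷ ps) zero    (suc j) eq = contradiction eq (lookup≢ p j)
      lookup-inj (p ∷ ps) (suc i) zero    eq = contradiction (sym eq) (lookup≢ p i)
      lookup-inj (p ∷ ps) (suc i) (suc j) eq = cong suc (lookup-inj ps i j eq)

    fresh : ∀ {v : V G} {vs} → v ∉ vs → Unique vs → Unique (v ∷ vs)
    fresh v∉vs uniq = ¬Any⇒All¬ _ v∉vs ∷ uniq

    wins-bounded : ∀ m k {ds ss} → Unique ds → order ≤ length ds + m →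
                   DominatorWins k ds ss → DominatorWins m ds ss
    wins-bounded zero    zero    uniq le w = w
    wins-bounded (suc m) zero    uniq le w = inj₁ w
    wins-bounded zero    (suc k) uniq le (inj₁ w) = w
    wins-bounded (suc m) (suc k) uniq le (inj₁ w) = inj₁ w
    wins-bounded zero    (suc k) {ds} uniq le (inj₂ ((v , v∉ds , _) , _)) =
      contradiction (ℕ.≤-trans (unique⇒length≤order (fresh v∉ds uniq))
                    (ℕ.≤-trans le (ℕ.≤-reflexive (ℕ.+-identityʳ _))))
                    (ℕ.<-irrefl refl)
    wins-bounded (suc m) (suc k) {ds} uniq le (inj₂ (ex , strat)) =
      inj₂ (ex , λ s fs → let d , fd , w = strat s fs in
        d , fd , wins-bounded m k (fresh (proj₁ fd) uniq)
                   (ℕ.≤-trans le (ℕ.≤-reflexive (ℕ.+-suc (length ds) m))) w)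

    leastFrom-just : ∀ j n {k} → (∀ i → i < j → ¬ DominatorWinsIn i) →
                     leastFrom j n ≡ [ k ] →
                     DominatorWinsIn k × (∀ i → i < k → ¬ DominatorWinsIn i)
    leastFrom-just j (suc n) below eq with dominatorWins? j [] []
    leastFrom-just j (suc n) below refl | yes w = w , below
    leastFrom-just j (suc n) below eq   | no ¬w = leastFrom-just (suc j) n below′ eq
      where
      below′ : ∀ i → i < suc j → ¬ DominatorWinsIn i
      below′ i i<1+j with ℕ.m<1+n⇒m<n∨m≡n i<1+j
      ... | inj₁ i<j  = below i i<j
      ... | inj₂ refl = ¬w

    leastFrom-nothing : ∀ j n → leastFrom j n ≡ ⊤⁺ →
                        ∀ i → j ≤ i → i < j + n → ¬ DominatorWinsIn i
    leastFrom-nothing j zero eq i j≤i i<j =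
      contradiction j≤i (ℕ.<⇒≱ (subst (i <_) (ℕ.+-identityʳ j) i<j))
    leastFrom-nothing j (suc n) eq i j≤i i<j with dominatorWins? j [] []
    leastFrom-nothing j (suc n) () i j≤i i<j | yes _
    leastFrom-nothing j (suc n) eq i j≤i i<j | no ¬w with ℕ.m≤n⇒m<n∨m≡n j≤i
    ... | inj₁ j<i  = leastFrom-nothing (suc j) n eq i j<i
                        (subst (i <_) (ℕ.+-suc j n) i<j)
    ... | inj₂ refl = ¬w

  γ′MB-finite : ∀ {k} → γ′MB ≡ [ k ] →
                DominatorWinsIn k × (∀ j → j < k → ¬ DominatorWinsIn j)
  γ′MB-finite = leastFrom-just 0 (suc order) λ _ ()

  γ′MB-infinite : γ′MB ≡ ⊤⁺ → ∀ k → ¬ DominatorWinsIn k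
  γ′MB-infinite eq k w =
    leastFrom-nothing 0 (suc order) eq order z≤n ℕ.≤-refl
      (wins-bounded order k [] ℕ.≤-refl w)

open Game public using (γ′MB)

Is2γ′MBCritical : Graph → Set
Is2γ′MBCritical G =
  γ′MB G ≡ [ 2 ] ×
  (∀ a b → Graph.Adj G a b → [ 2 ] <⁺ γ′MB (deleteEdge G a b))

edgeless : ℕ → Graph
edgeless n = record
  { V = Fin n ; adj = λ _ _ → false
  ; adj-sym = λ _ _ → refl ; adj-irrefl = λ _ → refl
  ; order = n ; enum = ↔-id _ }

complete : ℕ → Graph
complete n = record
  { V = Fin n ; adj = λ u v → not (does (u Fin.≟ v))
  ; adj-sym = λ u v → cong not (≟-sym u v)
  ; adj-irrefl = λ v → cong not (dec-true (v Fin.≟ v) refl)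
  ; order = n ; enum = ↔-id _ }
  where
  ≟-sym : ∀ (u v : Fin n) → does (u Fin.≟ v) ≡ does (v Fin.≟ u)
  ≟-sym u v with u Fin.≟ v
  ... | yes u≡v = sym (dec-true (v Fin.≟ u) (sym u≡v))
  ... | no  u≢v = sym (dec-false (v Fin.≟ u) (u≢v ∘ sym))

-- Disjoint union with all (cross = true) or none (cross = false) of the edges
-- between the two graphs.
sumGraph : Bool → Graph → Graph → Graph
sumGraph cross G H = record
  { V = V G ⊎ V H ; adj = adj ; adj-sym = adj-sym ; adj-irrefl = adj-irrefl
  ; order = G.order + H.order
  ; enum  = ↔-sym +↔⊎ ↔-∘ (G.enum ⊎-↔ H.enum) }
  where
  module G = Graph G
  module H = Graph H

  adj : V G ⊎ V H → V G ⊎ V H → Bool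
  adj (inj₁ u) (inj₁ v) = G.adj u v
  adj (inj₁ _) (inj₂ _) = cross
  adj (inj₂ _) (inj₁ _) = cross
  adj (inj₂ u) (inj₂ v) = H.adj u v

  adj-sym : ∀ u v → adj u v ≡ adj v u
  adj-sym (inj₁ u) (inj₁ v) = G.adj-sym u v
  adj-sym (inj₁ _) (inj₂ _) = refl
  adj-sym (inj₂ _) (inj₁ _) = refl
  adj-sym (inj₂ u) (inj₂ v) = H.adj-sym u v

  adj-irrefl : ∀ v → adj v v ≡ false
  adj-irrefl (inj₁ v) = G.adj-irrefl v
  adj-irrefl (inj₂ v) = H.adj-irrefl v

infixr 6 _⊕_ _∨ᴳ_

_⊕_ : Graph → Graph → Graph
_⊕_ = sumGraph false

_∨ᴳ_ : Graph → Graph → Graph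
_∨ᴳ_ = sumGraph true

addEdges : (G : Graph) (e : V G → V G → Bool) → (∀ v → e v v ≡ false) → Graph
addEdges G e e-irrefl = record
  { V          = V G
  ; adj        = λ u v → adj u v ∨ (e u v ∨ e v u)
  ; adj-sym    = λ u v → cong₂ _∨_ (adj-sym u v) (∨-comm (e u v) (e v u))
  ; adj-irrefl = λ v → cong₂ _∨_ (adj-irrefl v) (cong₂ _∨_ (e-irrefl v) (e-irrefl v))
  ; order      = order
  ; enum       = enum
  }
  where open Graph G hiding (V)

-- H m is only meant for m ≢ 1; the value at 1 is never used.
H : ℕ → Graph
H 0             = edgeless 0
H 1             = edgeless 1
H (suc (suc k)) = complete 2 ∨ᴳ edgeless k

module _ (m₁ t m₂ : ℕ) where
  F-parts : Graph
  F-parts = H m₁ ⊕ H m₂ ⊕ edgeless t ⊕ edgeless 2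

  pattern inH₁ h = inj₁ h
  pattern inH₂ h = inj₂ (inj₁ h)
  pattern inB  b = inj₂ (inj₂ (inj₁ b))
  pattern v₁     = inj₂ (inj₂ (inj₂ zero))
  pattern v₂     = inj₂ (inj₂ (inj₂ (suc zero)))

  F-new : V F-parts → V F-parts → Bool
  F-new v₁ (inH₁ _) = true
  F-new v₂ (inH₂ _) = true
  F-new v₁ (inB _)  = true
  F-new v₂ (inB _)  = true
  F-new _  _        = false

  F-new-irrefl : ∀ v → F-new v v ≡ false
  F-new-irrefl (inH₁ _) = refl
  F-new-irrefl (inH₂ _) = refl
  F-new-irrefl (inB _)  = refl
  F-new-irrefl v₁       = refl
  F-new-irrefl v₂       = refl

  F : Graph
  F = addEdges F-parts F-new F-new-irrefl

module _ (s q m : ℕ) where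
  -- The part {a, b} of K_{2,s} is the summand edgeless 2.
  P : Graph
  P = (edgeless 2 ∨ᴳ edgeless s) ⊕ edgeless (q ∸ 2)

  Q : Graph
  Q = complete 1 ∨ᴳ P

  F′-parts : Graph
  F′-parts = Q ⊕ H m ⊕ edgeless 1

  pattern inAB i = inj₁ (inj₂ (inj₁ (inj₁ i)))
  pattern inS  i = inj₁ (inj₂ (inj₁ (inj₂ i)))
  pattern inBs i = inj₁ (inj₂ (inj₂ i))
  pattern apex i = inj₁ (inj₁ i)
  pattern inH  h = inj₂ (inj₁ h)
  pattern vx   i = inj₂ (inj₂ i)

  F′-new : V F′-parts → V F′-parts → Bool
  F′-new (vx _) (inH _)  = true
  F′-new (vx _) (inAB _) = true
  F′-new (vx _) (inBs _) = true
  F′-new _      _        = false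

  F′-new-irrefl : ∀ v → F′-new v v ≡ false
  F′-new-irrefl (inAB _) = refl
  F′-new-irrefl (inS _)  = refl
  F′-new-irrefl (inBs _) = refl
  F′-new-irrefl (apex _) = refl
  F′-new-irrefl (inH _)  = refl
  F′-new-irrefl (vx _)   = refl

  F′ : Graph
  F′ = addEdges F′-parts F′-new F′-new-irrefl

infix 4 _∈𝓕 _∈𝓕′

record _∈𝓕 (G : Graph) : Set where
  field
    m₁ t m₂ : ℕ
    m₁≤m₂   : m₁ ≤ m₂
    m₁≢1    : m₁ ≢ 1
    2≤m₂    : 2 ≤ m₂
    1≤t     : 1 ≤ t
    2≤t     : m₁ ≡ 0 → 2 ≤ t
    iso     : G ≅ F m₁ t m₂

record _∈𝓕′ (G : Graph) : Set where
  field
    s q m : ℕ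
    2≤s   : 2 ≤ s
    2≤q   : 2 ≤ q
    2≤m   : 2 ≤ m
    iso   : G ≅ F′ s q m

{-# OPTIONS --safe #-}
module Submission where

-- Dominator wins the S-game within two moves iff, whatever s Staller opens with,
-- he has a reply d that dominates alone or that belongs to two dominating pairs
-- avoiding s.  This property Wins₂ is monotone under adding edges, so a critical
-- graph is an edge-minimal graph with Wins₂, and it is isomorphic to any graph
-- with Wins₂ that it contains as a spanning subgraph.
--
-- In F and F′ the dominating pairs form a double star (with centres v₁, v₂, and
-- the apex and x).  Let Staller open with one centre: for every edge one of the
-- two choices leaves at most one dominating pair once the edge is deleted.
--
-- Conversely, let x be a cut-vertex.  The reply c to the opening x and its two
-- partners w, w′ show that G − x splits into a part dominated by c and a part
-- dominated by both w and w′.  Edge-minimality and connectedness forbid that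
-- V(G) splits into two parts each dominated by two of its own vertices.  Given
-- this, the replies to the opening c (and once more to that reply) produce a
-- spanning copy of a member of 𝓕 or 𝓕′.
open import Defs
open import Data.Bool.Base using (true; false; T; not)
open import Data.Bool.Properties using (T?; T-∧; T-∨)
open import Data.Empty using (⊥; ⊥-elim)
open import Data.Fin.Base as Fin using (Fin; zero; suc)
open import Data.Fin.Properties using (pigeonhole)
open import Data.List.Base using (List; []; _∷_; length; lookup; filter; map; allFin)
open import Data.List.Membership.Propositional using (_∈_; _∉_)
open import Data.List.Membership.Propositional.Properties
  using (∈-filter⁺; ∈-filter⁻; ∈-lookup; ∈-map⁺; ∈-allFin)
open import Data.List.Relation.Unary.All as All using ([]; _∷_)
open import Data.List.Relation.Unary.AllPairs using (AllPairs; []; _∷_)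
open import Data.List.Relation.Unary.Any using (here; there; index)
open import Data.List.Relation.Unary.Any.Properties using (lookup-index)
open import Data.List.Relation.Unary.Unique.Propositional using (Unique)
open import Data.List.Relation.Unary.Unique.Propositional.Properties using (filter⁺; map⁺; allFin⁺)
open import Data.Nat.Base using (ℕ; zero; suc; _+_; _≤_; z≤n; s≤s; _<_)
import Data.Nat.Properties as ℕ
open import Data.Product.Base using (∃; ∃-syntax; _×_; _,_; proj₁; proj₂)
open import Data.Sum.Base as Sum using (_⊎_; inj₁; inj₂; [_,_]′)
open import Data.Unit.Base using (⊤; tt)
open import Function.Base using (_∘_; id; case_of_)
open import Function.Bundles using (_⇔_; mk⇔; _↔_; Inverse; Equivalence; mk↔ₛ′)
open import Function.Construct.Composition using (_↔-∘_)
open import Function.Construct.Identity using (↔-id)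
open import Function.Construct.Symmetry using (↔-sym)
open import Level using (0ℓ)
open import Relation.Binary.Construct.Add.Supremum.Strict _<_ using (_<⁺_; [_]; [_]<⊤⁺)
open import Relation.Binary.Construct.Closure.ReflexiveTransitive
  using (Star; ε; _◅_; _◅◅_; reverse)
open import Relation.Binary.PropositionalEquality
  using (_≡_; _≢_; refl; sym; trans; cong; cong₂; subst; ≢-sym)
open import Relation.Nullary using (¬_; Dec; yes; no; contradiction)
open import Relation.Nullary.Construct.Add.Supremum using (⊤⁺) renaming ([_] to fin)
open import Relation.Nullary.Decidable
  using (_×-dec_; _⊎-dec_; ¬?; dec-true; dec-false; decidable-stable)
open import Relation.Unary using (Pred; Decidable)

open Graph using (V)

-- Two-move wins in the S-game

module Domination (G : Graph) where
  open Graph G hiding (V)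

  Adj-sym : ∀ {u v} → Adj u v → Adj v u
  Adj-sym {u} {v} = subst T (adj-sym u v)

  Adj⇒≢ : ∀ {u v} → Adj u v → u ≢ v
  Adj⇒≢ {u} uv refl = subst T (adj-irrefl u) uv

  Covers : V G → V G → Set
  Covers u v = u ≡ v ⊎ Adj u v

  covers? : ∀ u v → Dec (Covers u v)
  covers? u v = (u ≟ v) ⊎-dec T? (adj u v)

  Covers-sym : ∀ {u v} → Covers u v → Covers v u
  Covers-sym = Sum.map sym Adj-sym

  Universal : V G → Set
  Universal u = ∀ v → Covers u v

  DomPair : V G → V G → Set
  DomPair u w = ∀ v → Covers u v ⊎ Covers w v

  DomPair-sym : ∀ {u w} → DomPair u w → DomPair w u
  DomPair-sym uw v = Sum.swap (uw v)

  record Fork (s d : V G) : Set where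
    constructor fork
    field
      {e₁ e₂} : V G
      e₁≢e₂   : e₁ ≢ e₂
      e₁≢s    : e₁ ≢ s
      e₂≢s    : e₂ ≢ s
      e₁≢d    : e₁ ≢ d
      e₂≢d    : e₂ ≢ d
      dom₁    : DomPair d e₁
      dom₂    : DomPair d e₂

  -- Dominator answers s by d and then holds two ways to complete a dominating
  -- pair, of which Staller can block only one.
  Wins₂ : Set
  Wins₂ = ∀ s → ∃[ d ] d ≢ s × (Universal d ⊎ Fork s d)

  open Game G using (Dominating; Free; DominatorWins; DominatorWinsIn;
                     γ′MB-finite; γ′MB-infinite)

  dominating⇒universal : ∀ {d} → Dominating (_∈ d ∷ []) → Universal d
  dominating⇒universal {d} D v with d ≟ v
  ... | yes d≡v = inj₁ d≡v
  ... | no  d≢v with D v (λ { (here refl) → d≢v refl })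
  ...   | _ , here refl , dv = inj₂ dv

  universal⇒dominating : ∀ {d} → Universal d → Dominating (_∈ d ∷ [])
  universal⇒dominating {d} U v v∉ with U v
  ... | inj₁ refl = contradiction (here refl) v∉
  ... | inj₂ dv   = d , here refl , dv

  dominating⇒domPair : ∀ {d e} → Dominating (_∈ e ∷ d ∷ []) → DomPair d e
  dominating⇒domPair {d} {e} D v with covers? d v | covers? e v
  ... | yes p  | _     = inj₁ p
  ... | no _   | yes q = inj₂ q
  ... | no ¬p  | no ¬q
    with D v (λ { (here refl) → ¬q (inj₁ refl) ; (there (here refl)) → ¬p (inj₁ refl) })
  ...   | _ , here refl , q         = inj₂ (inj₂ q)
  ...   | _ , there (here refl) , p = inj₁ (inj₂ p)

  domPair⇒dominating : ∀ {d e} → DomPair d e → Dominating (_∈ e ∷ d ∷ [])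
  domPair⇒dominating {d} {e} D v v∉ with D v
  ... | inj₁ (inj₁ refl) = contradiction (there (here refl)) v∉
  ... | inj₁ (inj₂ dv)   = d , there (here refl) , dv
  ... | inj₂ (inj₁ refl) = contradiction (here refl) v∉
  ... | inj₂ (inj₂ ev)   = e , here refl , ev

  ∉[_] : ∀ {v : V G} u → v ≢ u → v ∉ u ∷ []
  ∉[ u ] v≢u (here v≡u) = v≢u v≡u

  ∉⇒≢ : ∀ {v u : V G} {us} → v ∉ u ∷ us → v ≢ u
  ∉⇒≢ v∉ v≡u = v∉ (here v≡u)

  Wins₂⇒DominatorWinsIn : V G → Wins₂ → DominatorWinsIn 2
  Wins₂⇒DominatorWinsIn v W = inj₂ ((v , (λ ()) , λ ()) , λ s _ → reply s (W s))
    where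
    reply : ∀ s → ∃[ d ] d ≢ s × (Universal d ⊎ Fork s d) →
            ∃[ d ] Free [] (s ∷ []) d × DominatorWins 1 (d ∷ []) (s ∷ [])
    reply s (d , d≢s , inj₁ U) = d , ((λ ()) , ∉[ s ] d≢s) , inj₁ (universal⇒dominating U)
    reply s (d , d≢s , inj₂ φ) =
      d , ((λ ()) , ∉[ s ] d≢s) , inj₂ ((e₁ , ∉[ d ] e₁≢d , ∉[ s ] e₁≢s) , finish)
      where
      open Fork φ
      finish : ∀ s′ → Free (d ∷ []) (s ∷ []) s′ →
               ∃[ e ] Free (d ∷ []) (s′ ∷ s ∷ []) e × Dominating (_∈ e ∷ d ∷ [])
      finish s′ _ with e₁ ≟ s′
      ... | yes refl = e₂ , (∉[ d ] e₂≢d , λ { (here eq) → e₁≢e₂ (sym eq)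
                                            ; (there (here eq)) → e₂≢s eq })
                          , domPair⇒dominating dom₂
      ... | no e₁≢s′ = e₁ , (∉[ d ] e₁≢d , λ { (here eq) → e₁≢s′ eq
                                            ; (there (here eq)) → e₁≢s eq })
                          , domPair⇒dominating dom₁

  DominatorWinsIn⇒Wins₂ : DominatorWinsIn 2 → Wins₂
  DominatorWinsIn⇒Wins₂ (inj₁ D) s with () ← proj₁ (proj₂ (D s λ ()))
  DominatorWinsIn⇒Wins₂ (inj₂ (_ , strat)) s with strat s ((λ ()) , λ ())
  ... | d , (_ , d∉) , inj₁ D = d , ∉⇒≢ d∉ , inj₁ (dominating⇒universal D)
  ... | d , (_ , d∉) , inj₂ ((f , free) , strat′)
    -- The two partners arise as follows: `e` answers Staller's second move at the spare vertex `f`,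
    -- and `e′` answers a second move at `e` itself, so it differs from `e`.
    with strat′ f free
  ... | e , (e∉d , e∉s) , D with strat′ e (e∉d , e∉s ∘ there)
  ... | e′ , (e′∉d , e′∉s) , D′ =
    d , ∉⇒≢ d∉ , inj₂ (fork (≢-sym (∉⇒≢ e′∉s)) (∉⇒≢ (e∉s ∘ there)) (∉⇒≢ (e′∉s ∘ there))
                            (∉⇒≢ e∉d) (∉⇒≢ e′∉d)
                            (dominating⇒domPair D) (dominating⇒domPair D′))

  DominatorWinsIn1⇒universal : DominatorWinsIn 1 → V G → ∃ Universal
  DominatorWinsIn1⇒universal (inj₁ D) v with () ← proj₁ (proj₂ (D v λ ()))
  DominatorWinsIn1⇒universal (inj₂ ((s , free) , strat)) _ with strat s free
  ... | d , _ , D = d , dominating⇒universal D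

  DominatorWins-suc : ∀ k {ds ss} → DominatorWins k ds ss → DominatorWins (suc k) ds ss
  DominatorWins-suc zero    D        = inj₁ D
  DominatorWins-suc (suc k) (inj₁ D) = inj₁ D
  DominatorWins-suc (suc k) (inj₂ (ex , strat)) =
    inj₂ (ex , λ s free → let d , fd , w = strat s free in d , fd , DominatorWins-suc k w)

  private
    DominatorWins-≤2 : ∀ {k} → k ≤ 2 → DominatorWinsIn k → DominatorWinsIn 2
    DominatorWins-≤2 {0} _ = DominatorWins-suc 1 ∘ DominatorWins-suc 0
    DominatorWins-≤2 {1} _ = DominatorWins-suc 1
    DominatorWins-≤2 {2} _ = id
    DominatorWins-≤2 {suc (suc (suc _))} (s≤s (s≤s ()))

  γ′MB≡2⇒Wins₂ : γ′MB G ≡ fin 2 → Wins₂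
  γ′MB≡2⇒Wins₂ eq = DominatorWinsIn⇒Wins₂ (proj₁ (γ′MB-finite eq))

  -- A win in at most one move would produce a universal vertex, so excluding those rules out the
  -- values 0 and 1.
  Wins₂⇒γ′MB≡2 : V G → Wins₂ → (∀ u → ¬ Universal u) → γ′MB G ≡ fin 2
  Wins₂⇒γ′MB≡2 v W ¬U with γ′MB G in eq
  ... | ⊤⁺ = contradiction (Wins₂⇒DominatorWinsIn v W) (γ′MB-infinite eq 2)
  ... | fin 0 = let u , U = DominatorWinsIn1⇒universal
                              (DominatorWins-suc 0 (proj₁ (γ′MB-finite eq))) v
                in contradiction U (¬U u)
  ... | fin 1 = let u , U = DominatorWinsIn1⇒universal (proj₁ (γ′MB-finite eq)) v
                in contradiction U (¬U u)
  ... | fin 2 = refl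
  ... | fin (suc (suc (suc k))) =
    contradiction (Wins₂⇒DominatorWinsIn v W) (proj₂ (γ′MB-finite eq) 2 (s≤s (s≤s (s≤s z≤n))))

  γ′MB>2⇒¬Wins₂ : V G → fin 2 <⁺ γ′MB G → ¬ Wins₂
  γ′MB>2⇒¬Wins₂ v lt W with γ′MB G in eq
  γ′MB>2⇒¬Wins₂ v _ W       | ⊤⁺ = γ′MB-infinite eq 2 (Wins₂⇒DominatorWinsIn v W)
  γ′MB>2⇒¬Wins₂ v [ 2<k ] W | fin k = proj₂ (γ′MB-finite eq) 2 2<k (Wins₂⇒DominatorWinsIn v W)

  ¬Wins₂⇒γ′MB>2 : ¬ Wins₂ → fin 2 <⁺ γ′MB G
  ¬Wins₂⇒γ′MB>2 ¬W with γ′MB G in eq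
  ... | ⊤⁺ = [ 2 ]<⊤⁺
  ... | fin k with 2 ℕ.<? k
  ...   | yes 2<k = [ 2<k ]
  ...   | no  2≮k = contradiction
    (DominatorWinsIn⇒Wins₂ (DominatorWins-≤2 (ℕ.≮⇒≥ 2≮k) (proj₁ (γ′MB-finite eq)))) ¬W

  -- c answers every first move except c itself, which c′ answers.
  doubleStar⇒Wins₂ : ∀ {c c′ p p′ q q′} → c ≢ c′ →
    p ≢ p′ → p ≢ c → p′ ≢ c → p ≢ c′ → p′ ≢ c′ →
    q ≢ q′ → q ≢ c → q′ ≢ c → q ≢ c′ → q′ ≢ c′ →
    DomPair c c′ → DomPair c p → DomPair c p′ → DomPair c′ q → DomPair c′ q′ →
    Wins₂
  doubleStar⇒Wins₂ {c} {c′} {p} {p′} c≢c′ p≢p′ p≢c p′≢c p≢c′ p′≢c′ q≢q′ q≢c q′≢c q≢c′ q′≢c′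
                   cc′ cp cp′ c′q c′q′ s
    with c ≟ s
  ... | yes refl = c′ , ≢-sym c≢c′ , inj₂ (fork q≢q′ q≢c q′≢c q≢c′ q′≢c′ c′q c′q′)
  ... | no  c≢s with p ≟ s | p′ ≟ s
  ...   | no p≢s | no p′≢s = c , c≢s , inj₂ (fork p≢p′ p≢s p′≢s p≢c p′≢c cp cp′)
  ...   | no p≢s | yes refl =
    c , c≢s , inj₂ (fork p≢c′ p≢s (≢-sym p′≢c′) p≢c (≢-sym c≢c′) cp cc′)
  ...   | yes refl | _ =
    c , c≢s , inj₂ (fork p′≢c′ (≢-sym p≢p′) (≢-sym p≢c′) p′≢c (≢-sym c≢c′) cp′ cc′)

  -- The dominating pairs form a 4-cycle with sides `w`, `w′` and `z`, `z′`. An opening on the cycle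
  -- is answered by the opposite vertex, whose two partners are both still free.
  fourCycle⇒Wins₂ : ∀ {w w′ z z′} → w ≢ w′ → z ≢ z′ →
    w ≢ z → w ≢ z′ → w′ ≢ z → w′ ≢ z′ →
    DomPair w z → DomPair w z′ → DomPair w′ z → DomPair w′ z′ → Wins₂
  fourCycle⇒Wins₂ {w} {w′} {z} {z′} w≢w′ z≢z′ w≢z w≢z′ w′≢z w′≢z′ wz wz′ w′z w′z′ s
    with w ≟ s
  ... | yes refl =
    w′ , ≢-sym w≢w′ ,
    inj₂ (fork z≢z′ (≢-sym w≢z) (≢-sym w≢z′) (≢-sym w′≢z) (≢-sym w′≢z′) w′z w′z′)
  ... | no w≢s with z ≟ s | z′ ≟ s
  ...   | no z≢s | no z′≢s =
    w , w≢s , inj₂ (fork z≢z′ z≢s z′≢s (≢-sym w≢z) (≢-sym w≢z′) wz wz′)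
  ...   | yes refl | _ =
    z′ , ≢-sym z≢z′ ,
    inj₂ (fork w≢w′ w≢z w′≢z w≢z′ w′≢z′ (DomPair-sym wz′) (DomPair-sym w′z′))
  ...   | no z≢s | yes refl =
    z , z≢s ,
    inj₂ (fork w≢w′ w≢z′ w′≢z′ w≢z w′≢z (DomPair-sym wz) (DomPair-sym w′z))
open Domination

-- Edge deletion and edge-minimality

Bool-ext : ∀ {p q} → (T p → T q) → (T q → T p) → p ≡ q
Bool-ext {false} {false} _ _ = refl
Bool-ext {false} {true}  _ g with () ← g tt
Bool-ext {true}  {false} f _ with () ← f tt
Bool-ext {true}  {true}  _ _ = refl

module _ (G : Graph) (a b : V G) where
  open Graph G hiding (V)
  private
    G′ = deleteEdge G a b

    -- Repeats the decision made inside `deleteEdge`, so that `dec-true` and `dec-false` can rewrite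
    -- its Boolean adjacency.
    ab? : ∀ u v → Dec ((u ≡ a × v ≡ b) ⊎ (u ≡ b × v ≡ a))
    ab? u v = ((u ≟ a) ×-dec (v ≟ b)) ⊎-dec ((u ≟ b) ×-dec (v ≟ a))

  deleteEdge⁻ : ∀ {u v} → Graph.Adj G′ u v →
                Adj u v × ¬ ((u ≡ a × v ≡ b) ⊎ (u ≡ b × v ≡ a))
  deleteEdge⁻ {u} {v} uv with Equivalence.to T-∧ uv
  ... | uv∈G , ≢ab = uv∈G , λ eq → subst (T ∘ not) (dec-true (ab? u v) eq) ≢ab

  deleteEdge⁺ : ∀ {u v} → Adj u v → ¬ ((u ≡ a × v ≡ b) ⊎ (u ≡ b × v ≡ a)) →
                Graph.Adj G′ u v
  deleteEdge⁺ {u} {v} uv ≢ab =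
    Equivalence.from T-∧ (uv , subst (T ∘ not) (sym (dec-false (ab? u v) ≢ab)) tt)

  deleteEdge-Covers : ∀ {u v} → Covers G′ u v → Covers G u v
  deleteEdge-Covers = Sum.map₂ (proj₁ ∘ deleteEdge⁻)

  deleteEdge-DomPair : ∀ {u w} → DomPair G′ u w → DomPair G u w
  deleteEdge-DomPair D v = Sum.map deleteEdge-Covers deleteEdge-Covers (D v)

  deleteEdge-¬Covers : Adj a b → ¬ Covers G′ a b
  deleteEdge-¬Covers ab (inj₁ a≡b) = Adj⇒≢ G ab a≡b
  deleteEdge-¬Covers ab (inj₂ ab′) = proj₂ (deleteEdge⁻ ab′) (inj₁ (refl , refl))

  deleteEdge-¬Covers′ : Adj a b → ¬ Covers G′ b a
  deleteEdge-¬Covers′ ab = deleteEdge-¬Covers ab ∘ Covers-sym G′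

module _ {K G : Graph} (e : V K ↔ V G) where
  open Inverse e
  private
    from≡ : ∀ {x u} → x ≢ from u → to x ≢ u
    from≡ x≢ refl = x≢ (sym (strictlyInverseʳ _))

    to≢to : ∀ {u v} → u ≢ v → to u ≢ to v
    to≢to u≢v eq = u≢v (trans (sym (strictlyInverseʳ _)) (trans (cong from eq) (strictlyInverseʳ _)))

  -- A bijective homomorphism preserves covering, hence dominating pairs. A spanning subgraph
  -- therefore passes its replies on to the larger graph, the opening `s` being pulled back to
  -- `from s`.
  Wins₂-map : (∀ {u v} → Graph.Adj K u v → Graph.Adj G (to u) (to v)) → Wins₂ K → Wins₂ G
  Wins₂-map hom W s with W (from s)
  ... | d , d≢s , R = to d , from≡ d≢s , Sum.map universal forked R
    where
    covers : ∀ {u v} → Covers K u (from v) → Covers G (to u) v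
    covers {u} {v} = subst (Covers G (to u)) (strictlyInverseˡ v) ∘ Sum.map (cong to) hom

    universal : Universal K d → Universal G (to d)
    universal U v = covers (U (from v))

    domPair : ∀ {u w} → DomPair K u w → DomPair G (to u) (to w)
    domPair D v = Sum.map covers covers (D (from v))

    forked : Fork K (from s) d → Fork G s (to d)
    forked (fork e₁≢e₂ e₁≢s e₂≢s e₁≢d e₂≢d D₁ D₂) =
      fork (to≢to e₁≢e₂) (from≡ e₁≢s) (from≡ e₂≢s) (to≢to e₁≢d) (to≢to e₂≢d)
           (domPair D₁) (domPair D₂)

≅-sym : ∀ {G H} → G ≅ H → H ≅ G
≅-sym {G} {H} i = record
  { bijection = ↔-sym bijection
  ; preserves = λ u v → trans
      (sym (cong₂ (Graph.adj H) (strictlyInverseˡ u) (strictlyInverseˡ v)))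
      (sym (preserves (from u) (from v))) }
  where open _≅_ i
        open Inverse bijection

≅-trans : ∀ {G H K} → G ≅ H → H ≅ K → G ≅ K
≅-trans i j = record
  { bijection = _≅_.bijection j ↔-∘ _≅_.bijection i
  ; preserves = λ u v → trans (_≅_.preserves i u v) (_≅_.preserves j _ _) }

module _ {G H : Graph} (i : G ≅ H) where
  open _≅_ i
  open Inverse bijection

  ≅-Wins₂ : Wins₂ G → Wins₂ H
  ≅-Wins₂ = Wins₂-map bijection (λ {u} {v} → subst T (preserves u v))

  ≅-Universal : ∀ {u} → Universal G u → Universal H (to u)
  ≅-Universal {u} U v = subst (Covers H (to u)) (strictlyInverseˡ v)
    (Sum.map (cong to) (subst T (preserves u (from v))) (U (from v)))

  ≅-Wins₂-deleteEdge : ∀ a b → Wins₂ (deleteEdge G a b) → Wins₂ (deleteEdge H (to a) (to b))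
  ≅-Wins₂-deleteEdge a b = Wins₂-map bijection λ {u} {v} uv →
    let uv∈G , ≢ab = deleteEdge⁻ G a b uv
    in deleteEdge⁺ H (to a) (to b) (subst T (preserves u v) uv∈G)
         (≢ab ∘ Sum.map (λ (p , q) → inj p , inj q) (λ (p , q) → inj p , inj q))
    where
    inj : ∀ {u v} → to u ≡ to v → u ≡ v
    inj eq = trans (sym (strictlyInverseʳ _)) (trans (cong from eq) (strictlyInverseʳ _))

Wins₂-deleteEdge-comm : ∀ G a b → Wins₂ (deleteEdge G a b) → Wins₂ (deleteEdge G b a)
Wins₂-deleteEdge-comm G a b = Wins₂-map (↔-id _) λ uv →
  let uv∈G , ≢ab = deleteEdge⁻ G a b uv in deleteEdge⁺ G b a uv∈G (≢ab ∘ Sum.swap)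

Minimal : Graph → Set
Minimal G = ∀ a b → Graph.Adj G a b → ¬ Wins₂ (deleteEdge G a b)

-- An edge of G outside the image of K could be deleted without destroying the
-- copy of K, against minimality.
minimal⇒≅ : ∀ {G K} → Minimal G → Wins₂ K → (e : V K ↔ V G) →
  (∀ {u v} → Graph.Adj K u v → Graph.Adj G (Inverse.to e u) (Inverse.to e v)) → G ≅ K
minimal⇒≅ {G} {K} min W e hom = record
  { bijection = ↔-sym e
  ; preserves = λ u v → Bool-ext (reflects u v)
      (subst T (cong₂ (Graph.adj G) (strictlyInverseˡ u) (strictlyInverseˡ v)) ∘ hom) }
  where
  open Inverse e
  reflects : ∀ u v → Graph.Adj G u v → Graph.Adj K (from u) (from v)
  reflects u v uv with T? (Graph.adj K (from u) (from v))
  ... | yes p = p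
  ... | no ¬p = contradiction (Wins₂-map e hom′ W) (min u v uv)
    where
    hom′ : ∀ {u′ v′} → Graph.Adj K u′ v′ → Graph.Adj (deleteEdge G u v) (to u′) (to v′)
    hom′ {u′} {v′} uv′ = deleteEdge⁺ G u v (hom uv′) λ where
      (inj₁ (refl , refl)) → ¬p (subst T (sym (cong₂ (Graph.adj K)
        (strictlyInverseʳ u′) (strictlyInverseʳ v′))) uv′)
      (inj₂ (refl , refl)) → ¬p (subst T (sym (cong₂ (Graph.adj K)
        (strictlyInverseʳ v′) (strictlyInverseʳ u′))) (Adj-sym K uv′))

-- Spanning copies assembled from parts

-- G contains K on exactly the vertices satisfying Q, as a not necessarily
-- induced subgraph.
record Part (G K : Graph) (Q : Pred (V G) 0ℓ) : Set where
  field
    at       : V K → V G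
    at-inj   : ∀ {u v} → at u ≡ at v → u ≡ v
    sound    : ∀ u → Q (at u)
    onto     : ∀ {v} → Q v → ∃[ u ] at u ≡ v
    hom      : ∀ {u v} → Graph.Adj K u v → Graph.Adj G (at u) (at v)

open Part

lookup-injective : ∀ {A : Set} {xs : List A} → Unique xs → ∀ i j →
  lookup xs i ≡ lookup xs j → i ≡ j
lookup-injective {xs = _ ∷ _} _ zero zero    _  = refl
lookup-injective (x∉xs ∷ _) zero    (suc j) eq = contradiction eq (All.lookup x∉xs (∈-lookup j))
lookup-injective (x∉xs ∷ _) (suc i) zero    eq = contradiction (sym eq)
                                                         (All.lookup x∉xs (∈-lookup i))
lookup-injective (_ ∷ xs!)  (suc i) (suc j) eq = cong suc (lookup-injective xs! i j eq)

module _ {G : Graph} where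
  open Graph G hiding (V)

  Part⇒↔ : ∀ {K} → Part G K (λ _ → ⊤) → V K ↔ V G
  Part⇒↔ p = mk↔ₛ′ (at p) (λ v → proj₁ (onto p {v} tt)) (λ v → proj₂ (onto p tt))
                   (λ u → at-inj p (proj₂ (onto p tt)))

  Part⇒≅ : ∀ {K} → Minimal G → Wins₂ K → Part G K (λ _ → ⊤) → G ≅ K
  Part⇒≅ min W p = minimal⇒≅ min W (Part⇒↔ p) (λ {u} {v} → hom p {u} {v})

  Part-sum : ∀ {K L} cross {Q R : Pred (V G) 0ℓ} → Decidable R →
    Part G K (λ v → Q v × R v) → Part G L (λ v → Q v × ¬ R v) →
    (∀ {u v} → T cross → Q u → R u → Q v → ¬ R v → Adj u v) →
    Part G (sumGraph cross K L) Q
  Part-sum cross {R = R} R? p q join = record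
    { at       = [ at p , at q ]′
    ; at-inj   = λ { {inj₁ u} {inj₁ v} eq → cong inj₁ (at-inj p eq)
                   ; {inj₁ u} {inj₂ v} eq →
                       ⊥-elim (proj₂ (sound q v) (subst R eq (proj₂ (sound p u))))
                   ; {inj₂ u} {inj₁ v} eq →
                       ⊥-elim (proj₂ (sound q u) (subst R (sym eq) (proj₂ (sound p v))))
                   ; {inj₂ u} {inj₂ v} eq → cong inj₂ (at-inj q eq) }
    ; sound    = λ { (inj₁ u) → proj₁ (sound p u) ; (inj₂ u) → proj₁ (sound q u) }
    ; onto     = λ {v} Qv → case R? v of λ where
        (yes r) → let u , eq = onto p (Qv , r) in inj₁ u , eq
        (no ¬r) → let u , eq = onto q (Qv , ¬r) in inj₂ u , eq
    ; hom      = λ { {inj₁ u} {inj₁ v} uv → hom p uv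
                   ; {inj₁ u} {inj₂ v} t → joined t u v
                   ; {inj₂ u} {inj₁ v} t → Adj-sym G (joined t v u)
                   ; {inj₂ u} {inj₂ v} uv → hom q uv }
    }
    where
    joined : T cross → ∀ u v → Adj (at p u) (at q v)
    joined t u v = let Qu , Ru = sound p u ; Qv , ¬Rv = sound q v in join t Qu Ru Qv ¬Rv

  Part-addEdges : ∀ {K e irr Q} (p : Part G K Q) → (∀ {u v} → T (e u v) → Adj (at p u) (at p v)) →
    Part G (addEdges K e irr) Q
  Part-addEdges {K} {e} p new = record
    { at = at p ; at-inj = at-inj p ; sound = sound p ; onto = onto p
    ; hom = λ {u} {v} uv → case Equivalence.to (T-∨ {Graph.adj K u v}) uv of λ where
        (inj₁ old) → hom p old
        (inj₂ uv′) → case Equivalence.to (T-∨ {e u v}) uv′ of λ where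
          (inj₁ euv) → new euv
          (inj₂ evu) → Adj-sym G (new evu) }

  -- A part need not be induced, so any decidable vertex set will do; `n` is the number of its
  -- elements, found by filtering the enumeration of `G`.
  Part-edgeless : ∀ {Q : Pred (V G) 0ℓ} → Decidable Q → ∃[ n ] Part G (edgeless n) Q
  Part-edgeless {Q} Q? = length vs , record
    { at       = lookup vs
    ; at-inj   = λ {i} {j} → lookup-injective vs-unique i j
    ; sound    = λ i → proj₂ (∈-filter⁻ Q? {xs = all} (∈-lookup {xs = vs} i))
    ; onto     = λ {v} Qv →
        let v∈ = ∈-filter⁺ Q? (v∈all v) Qv in index v∈ , sym (lookup-index v∈)
    ; hom      = λ ()
    }
    where
    open Inverse enum

    all vs : List (V G)
    all = map from (allFin order)
    vs  = filter Q? all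

    v∈all : ∀ v → v ∈ all
    v∈all v = subst (_∈ all) (strictlyInverseʳ v) (∈-map⁺ from (∈-allFin (to v)))

    vs-unique : Unique vs
    vs-unique = filter⁺ Q? (map⁺ (λ eq → trans (sym (strictlyInverseˡ _))
      (trans (cong to eq) (strictlyInverseˡ _))) (allFin⁺ order))

  Part-one : ∀ {Q v} → Q v → (∀ {u} → Q u → u ≡ v) → Part G (edgeless 1) Q
  Part-one {v = v} Qv only = record
    { at = λ _ → v ; at-inj = λ { {zero} {zero} _ → refl } ; sound = λ _ → Qv
    ; onto = λ Qu → zero , sym (only Qu) ; hom = λ () }

  Part-complete : ∀ {n} {Q : Pred (V G) 0ℓ} (p : Part G (edgeless n) Q) →
    (∀ {u v} → Q u → Q v → u ≢ v → Adj u v) → Part G (complete n) Q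
  Part-complete p clique = record
    { at = at p ; at-inj = at-inj p ; sound = sound p ; onto = onto p
    ; hom = λ {u} {v} uv → clique (sound p u) (sound p v)
              λ eq → Adj⇒≢ (complete _) uv (at-inj p eq) }

  Part-two : ∀ {Q w w′} → w ≢ w′ → Q w → Q w′ → (∀ {v} → Q v → v ≡ w ⊎ v ≡ w′) →
    Part G (edgeless 2) Q
  Part-two {w = w} {w′} w≢w′ Qw Qw′ only = record
    { at       = λ { zero → w ; (suc zero) → w′ }
    ; at-inj   = λ { {zero} {zero} _ → refl
                   ; {zero} {suc zero} eq → contradiction eq w≢w′
                   ; {suc zero} {zero} eq → contradiction (sym eq) w≢w′
                   ; {suc zero} {suc zero} _ → refl }
    ; sound    = λ { zero → Qw ; (suc zero) → Qw′ }
    ; onto     = λ Qv → [ (λ eq → zero , sym eq) , (λ eq → suc zero , sym eq) ]′ (only Qv)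
    ; hom      = λ ()
    }

  -- The two vertices that cover all of `Q` serve as the adjacent hubs of $H_m$, and everything else
  -- in `Q` becomes a leaf.
  Part-H : ∀ {Q : Pred (V G) 0ℓ} {w w′} → Decidable Q → w ≢ w′ → Q w → Q w′ →
    (∀ {v} → Q v → Covers G w v) → (∀ {v} → Q v → Covers G w′ v) →
    ∃[ k ] Part G (H (2 + k)) Q
  Part-H {Q} {w} {w′} Q? w≢w′ Qw Qw′ cov cov′ =
    let k , leaves = Part-edgeless (λ v → Q? v ×-dec ¬? (hub? v))
    in k , Part-sum true hub?
      (Part-complete (Part-two w≢w′ (Qw , inj₁ refl) (Qw′ , inj₂ refl) proj₂)
        λ { (_ , h) (Qv , _) u≢v → hub-adj h Qv u≢v })
      leaves λ { _ _ h Qv ¬h → hub-adj h Qv λ { refl → ¬h h } }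
    where
    hub? : Decidable (λ v → v ≡ w ⊎ v ≡ w′)
    hub? v = (v ≟ w) ⊎-dec (v ≟ w′)

    hub-adj : ∀ {u v} → u ≡ w ⊎ u ≡ w′ → Q v → u ≢ v → Adj u v
    hub-adj (inj₁ refl) Qv u≢v = [ (λ eq → contradiction eq u≢v) , id ]′ (cov Qv)
    hub-adj (inj₂ refl) Qv u≢v = [ (λ eq → contradiction eq u≢v) , id ]′ (cov′ Qv)

  Part⇒1≤ : ∀ {n Q} → Part G (edgeless n) Q → ∃ Q → 1 ≤ n
  Part⇒1≤ {zero}  p (_ , Qv) with () ← proj₁ (onto p Qv)
  Part⇒1≤ {suc _} p _ = s≤s z≤n

  Part⇒2≤ : ∀ {n Q u v} → Part G (edgeless n) Q → u ≢ v → Q u → Q v → 2 ≤ n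
  Part⇒2≤ {zero} p _ Qu _ with () ← proj₁ (onto p Qu)
  Part⇒2≤ {suc zero} p u≢v Qu Qv with onto p Qu | onto p Qv
  ... | zero , eq | zero , eq′ = contradiction (trans (sym eq) eq′) u≢v
  Part⇒2≤ {suc (suc _)} p _ _ _ = s≤s (s≤s z≤n)

-- Three-colouring of the graphs $H_m$

AllPairs-lookup : ∀ {A : Set} {R : A → A → Set} {xs} → AllPairs R xs →
  ∀ {i j} → i Fin.< j → R (lookup xs i) (lookup xs j)
AllPairs-lookup (rs ∷ _)  {zero}  {suc j} _         = All.lookup rs (∈-lookup j)
AllPairs-lookup (_ ∷ rss) {suc i} {suc j} (s≤s i<j) = AllPairs-lookup rss i<j

-- Three colours suffice, which by the pigeonhole principle excludes a $K_4$ in $H_m$.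
H-colour : ∀ m → V (H m) → Fin 3
H-colour 1             _              = zero
H-colour (suc (suc _)) (inj₁ zero)    = zero
H-colour (suc (suc _)) (inj₁ (suc _)) = suc zero
H-colour (suc (suc _)) (inj₂ _)       = suc (suc zero)

H-colour-proper : ∀ m {u v} → Graph.Adj (H m) u v → H-colour m u ≢ H-colour m v
H-colour-proper 1 ()
H-colour-proper (suc (suc _)) {inj₁ zero}       {inj₁ zero}       ()
H-colour-proper (suc (suc _)) {inj₁ zero}       {inj₁ (suc zero)} _ ()
H-colour-proper (suc (suc _)) {inj₁ (suc zero)} {inj₁ zero}       _ ()
H-colour-proper (suc (suc _)) {inj₁ (suc zero)} {inj₁ (suc zero)} ()
H-colour-proper (suc (suc _)) {inj₁ zero}       {inj₂ _}          _ ()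
H-colour-proper (suc (suc _)) {inj₁ (suc _)}    {inj₂ _}          _ ()
H-colour-proper (suc (suc _)) {inj₂ _}          {inj₁ zero}       _ ()
H-colour-proper (suc (suc _)) {inj₂ _}          {inj₁ (suc _)}    _ ()

H-K₄-free : ∀ m {u v w x} → ¬ AllPairs (Graph.Adj (H m)) (u ∷ v ∷ w ∷ x ∷ [])
H-K₄-free m {u} {v} {w} {x} clique =
  let i , j , i<j , eq = pigeonhole ℕ.≤-refl (H-colour m ∘ lookup (u ∷ v ∷ w ∷ x ∷ []))
  in H-colour-proper m (AllPairs-lookup clique i<j) eq

-- Criticality of F

pattern hub₀ = inj₁ zero
pattern hub₁ = inj₁ (suc zero)

hub₀-universal : ∀ {k} → Universal (H (suc (suc k))) hub₀
hub₀-universal hub₀     = inj₁ refl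
hub₀-universal hub₁     = inj₂ tt
hub₀-universal (inj₂ _) = inj₂ tt

hub₁-universal : ∀ {k} → Universal (H (suc (suc k))) hub₁
hub₁-universal hub₀     = inj₂ tt
hub₁-universal hub₁     = inj₁ refl
hub₁-universal (inj₂ _) = inj₂ tt

module _ {G : Graph} {c c′ : V G} (¬U : ∀ u → ¬ Universal G u)
         (meets : ∀ {p r} → DomPair G p r → (p ≡ c ⊎ p ≡ c′) ⊎ (r ≡ c ⊎ r ≡ c′)) where

  -- If Staller opens with c′, every dominating pair left to Dominator contains c.
  ¬Wins₂-deleteEdge : ∀ a b →
    (∀ {p p′} → p ≢ c → p ≢ c′ → p′ ≢ c → p′ ≢ c′ →
       DomPair (deleteEdge G a b) c p → DomPair (deleteEdge G a b) c p′ → p ≡ p′) →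
    ¬ Wins₂ (deleteEdge G a b)
  ¬Wins₂-deleteEdge a b unique W with W c′
  ... | d , _ , inj₁ U = ¬U d (deleteEdge-Covers G a b ∘ U)
  ... | d , d≢c′ , inj₂ (fork e₁≢e₂ e₁≢c′ e₂≢c′ e₁≢d e₂≢d D₁ D₂)
    with meets (deleteEdge-DomPair G a b D₁) | meets (deleteEdge-DomPair G a b D₂)
  ... | inj₁ (inj₁ refl) | _ = e₁≢e₂ (unique e₁≢d e₁≢c′ e₂≢d e₂≢c′ D₁ D₂)
  ... | inj₁ (inj₂ eq)   | _ = d≢c′ eq
  ... | inj₂ (inj₂ eq)   | _ = e₁≢c′ eq
  ... | inj₂ (inj₁ refl) | inj₁ (inj₁ eq) = e₁≢d (sym eq)
  ... | inj₂ (inj₁ refl) | inj₁ (inj₂ eq) = d≢c′ eq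
  ... | inj₂ (inj₁ refl) | inj₂ (inj₁ eq) = e₁≢e₂ (sym eq)
  ... | inj₂ (inj₁ refl) | inj₂ (inj₂ eq) = e₂≢c′ eq

-- Two partners i, j of c in G minus the edge hg would form a K₄ with h and g.
leg-partner-unique : ∀ G m {c : V G} (leg : V (H m) → V G) →
  (∀ {h g} → h ≢ g → Covers G (leg h) (leg g) → Graph.Adj (H m) h g) →
  (∀ {h} → ¬ Covers G c (leg h)) →
  ∀ h g → Graph.Adj G (leg h) (leg g) →
  let G′ = deleteEdge G (leg h) (leg g) in
  ∀ {i j} → DomPair G′ c (leg i) → DomPair G′ c (leg j) → i ≡ j
leg-partner-unique G m {c} leg reflect ¬c h g hg {i} {j} D D′ with Graph._≟_ (H m) i j
... | yes i≡j = i≡j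
... | no  i≢j = contradiction
  ((adjacent i≢j D ∷ adjacent (≢h D) D ∷ adjacent (≢g D) D ∷ []) ∷
   (adjacent (≢h D′) D′ ∷ adjacent (≢g D′) D′ ∷ []) ∷
   (reflect h≢g (inj₂ hg) ∷ []) ∷ [] ∷ [])
  (H-K₄-free m {i} {j} {h} {g})
  where
  G′ = deleteEdge G (leg h) (leg g)

  covered : ∀ {p l} → DomPair G′ c (leg p) → Covers G′ (leg p) (leg l)
  covered {l = l} D = [ ⊥-elim ∘ ¬c ∘ deleteEdge-Covers G (leg h) (leg g) , id ]′ (D (leg l))

  adjacent : ∀ {p l} → p ≢ l → DomPair G′ c (leg p) → Graph.Adj (H m) p l
  adjacent p≢l D = reflect p≢l (deleteEdge-Covers G (leg h) (leg g) (covered D))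

  ≢h : ∀ {p} → DomPair G′ c (leg p) → p ≢ h
  ≢h D refl = deleteEdge-¬Covers G (leg h) (leg g) hg (covered D)

  ≢g : ∀ {p} → DomPair G′ c (leg p) → p ≢ g
  ≢g D refl = deleteEdge-¬Covers′ G (leg h) (leg g) hg (covered D)

  h≢g : h ≢ g
  h≢g refl = Adj⇒≢ G hg refl

-- This symmetry turns statements about `v₁` and the second leg into statements about `v₂` and the
-- first leg, and later lets the legs be ordered by size.
F-swap : ∀ m₁ t m₂ → F m₁ t m₂ ≅ F m₂ t m₁
F-swap m₁ t m₂ = record
  { bijection = mk↔ₛ′ (turn m₁ m₂) (turn m₂ m₁) (turn-turn m₂ m₁) (turn-turn m₁ m₂)
  ; preserves = preserves }
  where
  turn : ∀ m n → V (F m t n) → V (F n t m)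
  turn _ _ (inH₁ h) = inH₂ h
  turn _ _ (inH₂ h) = inH₁ h
  turn _ _ (inB b)  = inB b
  turn _ _ v₁       = v₂
  turn _ _ v₂       = v₁

  turn-turn : ∀ m n v → turn n m (turn m n v) ≡ v
  turn-turn _ _ (inH₁ _) = refl
  turn-turn _ _ (inH₂ _) = refl
  turn-turn _ _ (inB _)  = refl
  turn-turn _ _ v₁       = refl
  turn-turn _ _ v₂       = refl

  preserves : ∀ u v → Graph.adj (F m₁ t m₂) u v ≡
                      Graph.adj (F m₂ t m₁) (turn m₁ m₂ u) (turn m₁ m₂ v)
  preserves (inH₁ _) (inH₁ _) = refl
  preserves (inH₁ _) (inH₂ _) = refl
  preserves (inH₁ _) (inB _)  = refl
  preserves (inH₁ _) v₁       = refl
  preserves (inH₁ _) v₂       = refl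
  preserves (inH₂ _) (inH₁ _) = refl
  preserves (inH₂ _) (inH₂ _) = refl
  preserves (inH₂ _) (inB _)  = refl
  preserves (inH₂ _) v₁       = refl
  preserves (inH₂ _) v₂       = refl
  preserves (inB _)  (inH₁ _) = refl
  preserves (inB _)  (inH₂ _) = refl
  preserves (inB _)  (inB _)  = refl
  preserves (inB _)  v₁       = refl
  preserves (inB _)  v₂       = refl
  preserves v₁       (inH₁ _) = refl
  preserves v₁       (inH₂ _) = refl
  preserves v₁       (inB _)  = refl
  preserves v₁       v₁       = refl
  preserves v₁       v₂       = refl
  preserves v₂       (inH₁ _) = refl
  preserves v₂       (inH₂ _) = refl
  preserves v₂       (inB _)  = refl
  preserves v₂       v₁       = refl
  preserves v₂       v₂       = refl

-- The admissible pairs $(m_1, t)$. Without a first leg the two spare partners of `v₂` must come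
-- from $B$, which forces $t$ to be at least 2. The ordering of the legs is left out so that they
-- can be swapped freely.
data Shape : ℕ → ℕ → Set where
  twoLegs : ∀ k t → Shape (suc (suc k)) (suc t)
  oneLeg  : ∀ t → Shape 0 (suc (suc t))

module _ (m₁ t k : ℕ) where
  private
    K = F m₁ t (suc (suc k))

    pattern z₀ = inH₂ hub₀
    pattern z₁ = inH₂ hub₁

  leg₂⁺ : ∀ {h g} → Covers (H (suc (suc k))) h g → Covers K (inH₂ h) (inH₂ g)
  leg₂⁺ = Sum.map (cong (λ h → inH₂ h)) (Equivalence.from T-∨ ∘ inj₁)

  leg₂⁻ : ∀ {h g} → h ≢ g → Covers K (inH₂ h) (inH₂ g) → Graph.Adj (H (suc (suc k))) h g
  leg₂⁻ h≢g (inj₁ refl) = contradiction refl h≢g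
  leg₂⁻ {h} {g} h≢g (inj₂ hg) with Equivalence.to (T-∨ {Graph.adj (H (suc (suc k))) h g}) hg
  ... | inj₁ p = p

  data Covers₂ : V K → Set where
    inLeg    : ∀ h → Covers₂ (inH₂ h)
    atCentre : Covers₂ v₂

  covers₂ : ∀ {p h} → Covers K p (inH₂ h) → Covers₂ p
  covers₂ {inH₁ _} (inj₂ ())
  covers₂ {inH₂ h} _ = inLeg h
  covers₂ {inB _}  (inj₂ ())
  covers₂ {v₁}     (inj₂ ())
  covers₂ {v₂}     _ = atCentre

  coversB : ∀ {p b} → Covers K p (inB b) → p ≡ inB b ⊎ (p ≡ v₁ ⊎ p ≡ v₂)
  coversB {inB _}  (inj₁ eq) = inj₁ eq
  coversB {inH₁ _} (inj₂ ())
  coversB {inH₂ _} (inj₂ ())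
  coversB {inB _}  (inj₂ ())
  coversB {v₁}     _ = inj₂ (inj₁ refl)
  coversB {v₂}     _ = inj₂ (inj₂ refl)

  F-¬Universal : ∀ u → ¬ Universal K u
  F-¬Universal u U with covers₂ (U z₀)
  F-¬Universal _ U | inLeg _ with U v₁
  ... | inj₁ ()
  ... | inj₂ ()
  F-¬Universal _ U | atCentre with U v₁
  ... | inj₁ ()
  ... | inj₂ ()

  v₁v₂-dom : DomPair K v₁ v₂
  v₁v₂-dom (inH₁ _) = inj₁ (inj₂ tt)
  v₁v₂-dom (inH₂ _) = inj₂ (inj₂ tt)
  v₁v₂-dom (inB _)  = inj₁ (inj₂ tt)
  v₁v₂-dom v₁       = inj₁ (inj₁ refl)
  v₁v₂-dom v₂       = inj₂ (inj₁ refl)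

  v₁z-dom : ∀ {h} → Universal (H (suc (suc k))) h → DomPair K v₁ (inH₂ h)
  v₁z-dom U (inH₁ _) = inj₁ (inj₂ tt)
  v₁z-dom U (inH₂ g) = inj₂ (leg₂⁺ (U g))
  v₁z-dom U (inB _)  = inj₁ (inj₂ tt)
  v₁z-dom U v₁       = inj₁ (inj₁ refl)
  v₁z-dom U v₂       = inj₂ (inj₂ tt)

module _ {m₁ t : ℕ} where
  v₂w-dom : ∀ {m₂ h} → Universal (H m₁) h → DomPair (F m₁ t m₂) v₂ (inH₁ h)
  v₂w-dom U (inH₁ g) = inj₂ (Sum.map (cong (λ h → inH₁ h)) (Equivalence.from T-∨ ∘ inj₁) (U g))
  v₂w-dom U (inH₂ _) = inj₁ (inj₂ tt)
  v₂w-dom U (inB _)  = inj₁ (inj₂ tt)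
  v₂w-dom U v₁       = inj₂ (inj₂ tt)
  v₂w-dom U v₂       = inj₁ (inj₁ refl)

v₂b-dom : ∀ {t m₂ b} → DomPair (F 0 t m₂) v₂ (inB b)
v₂b-dom (inH₂ _) = inj₁ (inj₂ tt)
v₂b-dom (inB _)  = inj₁ (inj₂ tt)
v₂b-dom v₁       = inj₂ (inj₂ tt)
v₂b-dom v₂       = inj₁ (inj₁ refl)

F-Wins₂ : ∀ {m₁ t} k → Shape m₁ t → Wins₂ (F m₁ t (suc (suc k)))
F-Wins₂ k (twoLegs k₁ t) = doubleStar⇒Wins₂ (F (suc (suc k₁)) (suc t) (suc (suc k)))
  {c = v₁} {c′ = v₂} {p = inH₂ hub₀} {p′ = inH₂ hub₁} {q = inH₁ hub₀} {q′ = inH₁ hub₁}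
  (λ ()) (λ ()) (λ ()) (λ ()) (λ ()) (λ ()) (λ ()) (λ ()) (λ ()) (λ ()) (λ ())
  (v₁v₂-dom _ _ k) (v₁z-dom _ _ k hub₀-universal) (v₁z-dom _ _ k hub₁-universal)
  (v₂w-dom hub₀-universal) (v₂w-dom hub₁-universal)
F-Wins₂ k (oneLeg t) = doubleStar⇒Wins₂ (F 0 (suc (suc t)) (suc (suc k)))
  {c = v₁} {c′ = v₂} {p = inH₂ hub₀} {p′ = inH₂ hub₁} {q = inB zero} {q′ = inB (suc zero)}
  (λ ()) (λ ()) (λ ()) (λ ()) (λ ()) (λ ()) (λ ()) (λ ()) (λ ()) (λ ()) (λ ())
  (v₁v₂-dom _ _ k) (v₁z-dom _ _ k hub₀-universal) (v₁z-dom _ _ k hub₁-universal)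
  v₂b-dom v₂b-dom

module _ {m₁ t : ℕ} (k : ℕ) (shape : Shape m₁ t) where
  private
    K = F m₁ t (suc (suc k))

    -- A vertex of $B$; the shape is inspected because only then is `t` visibly a successor.
    b₀ : Shape m₁ t → V K
    b₀ (twoLegs _ _) = inB zero
    b₀ (oneLeg _)    = inB zero

    b₀-partner : ∀ {p} σ → DomPair K (b₀ σ) p → p ≡ v₁ ⊎ p ≡ v₂
    b₀-partner (twoLegs _ _) D with D (inH₂ hub₀) | D (inH₁ hub₀)
    ... | inj₁ (inj₂ ()) | _
    ... | inj₂ _         | inj₁ (inj₂ ())
    ... | inj₂ c         | inj₂ c′ with covers₂ m₁ t k c
    ...   | inLeg _  = case c′ of λ { (inj₁ ()) ; (inj₂ ()) }
    ...   | atCentre = inj₂ refl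
    b₀-partner (oneLeg _) D with D (inH₂ hub₀) | D (inB (suc zero))
    ... | inj₁ (inj₂ ()) | _
    ... | inj₂ _         | inj₁ (inj₁ ())
    ... | inj₂ _         | inj₁ (inj₂ ())
    ... | inj₂ c         | inj₂ c′ with coversB m₁ t k c′
    ...   | inj₁ refl = case c of λ { (inj₁ ()) ; (inj₂ ()) }
    ...   | inj₂ eq   = eq

    coversb₀ : ∀ {p} σ → Covers K p (b₀ σ) → p ≡ b₀ σ ⊎ (p ≡ v₁ ⊎ p ≡ v₂)
    coversb₀ (twoLegs _ _) = coversB m₁ t k
    coversb₀ (oneLeg _)    = coversB m₁ t k

  -- Some member of the pair covers `b₀`, so it is `b₀` or a centre. If it is `b₀`, the other member
  -- must cover what `b₀` misses in a leg and in the first leg or the rest of $B$, which leaves only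
  -- a centre.
  F-meets : ∀ {p r} → DomPair K p r → (p ≡ v₁ ⊎ p ≡ v₂) ⊎ (r ≡ v₁ ⊎ r ≡ v₂)
  F-meets D with Sum.map (coversb₀ shape) (coversb₀ shape) (D (b₀ shape))
  ... | inj₁ (inj₂ eq)   = inj₁ eq
  ... | inj₂ (inj₂ eq)   = inj₂ eq
  ... | inj₁ (inj₁ refl) = inj₂ (b₀-partner shape D)
  ... | inj₂ (inj₁ refl) = inj₁ (b₀-partner shape (DomPair-sym K D))

  private
    v₁-partner : ∀ a b {p} → DomPair (deleteEdge K a b) v₁ p → p ≢ v₂ → ∃[ h ] p ≡ inH₂ h
    v₁-partner a b D p≢v₂ with D (inH₂ hub₀)
    ... | inj₁ c = case deleteEdge-Covers K a b c of λ { (inj₁ ()) ; (inj₂ ()) }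
    ... | inj₂ c with covers₂ m₁ t k (deleteEdge-Covers K a b c)
    ...   | inLeg h  = h , refl
    ...   | atCentre = contradiction refl p≢v₂

  -- Staller opens with `v₂`. Partners of `v₁` then lie in the second leg and cover no neighbour of
  -- `v₁`, so once `v₁y` is gone nothing covers `y` and no partner remains.
  F-minimal-v₁ : ∀ y → Graph.Adj K v₁ y → ¬ Wins₂ (deleteEdge K v₁ y)
  F-minimal-v₁ y v₁y = ¬Wins₂-deleteEdge (F-¬Universal m₁ t k) F-meets v₁ y
    λ p≢v₁ p≢v₂ _ _ D _ → let h , eq = v₁-partner v₁ y D p≢v₂ in
      [ (λ c → ⊥-elim (deleteEdge-¬Covers K v₁ y v₁y c))
      , (λ c → ⊥-elim (far y v₁y (subst (λ p → Covers K p y) eq (deleteEdge-Covers K v₁ y c)))) ]′ (D y)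
    where
    far : ∀ y {h} → Graph.Adj K v₁ y → ¬ Covers K (inH₂ h) y
    far (inH₁ _) _ (inj₂ ())
    far (inB _)  _ (inj₂ ())
    far v₁ ()
    far v₂ ()

  -- Staller opens with `v₂`, so the partners of `v₁` lie in the damaged leg, where at most one is
  -- left.
  F-minimal-leg₂ : ∀ h g → Graph.Adj K (inH₂ h) (inH₂ g) →
                   ¬ Wins₂ (deleteEdge K (inH₂ h) (inH₂ g))
  F-minimal-leg₂ h g hg = ¬Wins₂-deleteEdge (F-¬Universal m₁ t k) F-meets (inH₂ h) (inH₂ g) unique
    where
    unique : ∀ {p p′} → p ≢ v₁ → p ≢ v₂ → p′ ≢ v₁ → p′ ≢ v₂ →
             let K′ = deleteEdge K (inH₂ h) (inH₂ g) in
             DomPair K′ v₁ p → DomPair K′ v₁ p′ → p ≡ p′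
    unique _ p≢v₂ _ p′≢v₂ D D′
      with v₁-partner (inH₂ h) (inH₂ g) D p≢v₂ | v₁-partner (inH₂ h) (inH₂ g) D′ p′≢v₂
    ... | i , refl | j , refl = cong (λ h → inH₂ h)
      (leg-partner-unique K (suc (suc k)) (λ h → inH₂ h) (leg₂⁻ m₁ t k)
        (λ { (inj₁ ()) ; (inj₂ ()) }) h g hg D D′)

module _ (t k : ℕ) where
  private
    K = F 0 (suc (suc t)) (suc (suc k))

    v₂-partner : ∀ a b {p} → DomPair (deleteEdge K a b) v₂ p → p ≢ v₁ → ∃[ b ] p ≡ inB b
    v₂-partner a b {p} D p≢v₁
      with p | Sum.map (deleteEdge-Covers K a b) (deleteEdge-Covers K a b) (D v₁)
    ... | _      | inj₁ (inj₁ ())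
    ... | _      | inj₁ (inj₂ ())
    ... | inB i  | inj₂ _ = i , refl
    ... | v₁     | inj₂ _ = contradiction refl p≢v₁
    ... | inH₂ _ | inj₂ (inj₂ ())
    ... | v₂     | inj₂ (inj₂ ())

  -- Staller opens with `v₁`. Partners of `v₂` then lie in $B$, and such a vertex covers no
  -- neighbour of `v₂` but itself. Without the edge `v₂y` the only possible partner is `y`.
  F-minimal-v₂ : ∀ y → Graph.Adj K v₂ y → ¬ Wins₂ (deleteEdge K v₂ y)
  F-minimal-v₂ y v₂y = ¬Wins₂-deleteEdge (F-¬Universal _ _ k)
    (λ D → Sum.map Sum.swap Sum.swap (F-meets k (oneLeg t) D)) v₂ y
    λ {p} {p′} _ p≢v₁ _ p′≢v₁ D D′ → trans (only p≢v₁ D) (sym (only p′≢v₁ D′))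
    where
    near : ∀ y {b} → Graph.Adj K v₂ y → Covers K (inB b) y → inB b ≡ y
    near (inB _)  _ (inj₁ eq) = eq
    near (inB _)  _ (inj₂ ())
    near (inH₂ _) _ (inj₂ ())
    near v₁ ()
    near v₂ ()

    only : ∀ {p} → p ≢ v₁ → DomPair (deleteEdge K v₂ y) v₂ p → p ≡ y
    only p≢v₁ D with v₂-partner v₂ y D p≢v₁ | D y
    ... | _        | inj₁ c = contradiction c (deleteEdge-¬Covers K v₂ y v₂y)
    ... | _ , refl | inj₂ c = near y v₂y (deleteEdge-Covers K v₂ y c)

module _ (k : ℕ) where
  private
    at-v₁ : ∀ {m₁ t} → Shape m₁ t → ∀ y → let K = F m₁ t (suc (suc k)) in
            Graph.Adj K v₁ y → ¬ Wins₂ (deleteEdge K v₁ y)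
    at-v₁ = F-minimal-v₁ k

    -- With two legs this is the case of `v₁` after swapping; with one leg the partners of `v₂` lie
    -- in $B$ and need their own argument.
    at-v₂ : ∀ {m₁ t} → Shape m₁ t → ∀ y → let K = F m₁ t (suc (suc k)) in
            Graph.Adj K v₂ y → ¬ Wins₂ (deleteEdge K v₂ y)
    at-v₂ (oneLeg t)     y v₂y   = F-minimal-v₂ t k y v₂y
    at-v₂ (twoLegs k₁ t) y v₂y W =
      F-minimal-v₁ k₁ (twoLegs k t) (Inverse.to (_≅_.bijection turn) y)
        (subst T (_≅_.preserves turn v₂ y) v₂y) (≅-Wins₂-deleteEdge turn v₂ y W)
      where turn = F-swap (suc (suc k₁)) (suc t) (suc (suc k))

  F-Minimal : ∀ {m₁ t} → Shape m₁ t → Minimal (F m₁ t (suc (suc k)))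
  F-Minimal σ v₁ y = at-v₁ σ y
  F-Minimal σ v₂ y = at-v₂ σ y
  F-Minimal σ (inH₂ h) (inH₂ g) = F-minimal-leg₂ k σ h g
  F-Minimal (twoLegs k₁ t) (inH₁ h) (inH₁ g) hg W =
    F-minimal-leg₂ k₁ (twoLegs k t) h g hg
      (≅-Wins₂-deleteEdge (F-swap (suc (suc k₁)) (suc t) (suc (suc k))) (inH₁ h) (inH₁ g) W)
  F-Minimal σ x@(inH₁ _) v₁ _ = at-v₁ σ x tt ∘ Wins₂-deleteEdge-comm _ x v₁
  F-Minimal σ x@(inB _)  v₁ _ = at-v₁ σ x tt ∘ Wins₂-deleteEdge-comm _ x v₁
  F-Minimal σ x@(inH₂ _) v₂ _ = at-v₂ σ x tt ∘ Wins₂-deleteEdge-comm _ x v₂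
  F-Minimal σ x@(inB _)  v₂ _ = at-v₂ σ x tt ∘ Wins₂-deleteEdge-comm _ x v₂
  F-Minimal _ (inH₁ _) v₂ ()
  F-Minimal _ (inH₂ _) v₁ ()

-- Criticality of F′

module _ (s r k : ℕ) where
  private
    K = F′ (suc (suc s)) (suc (suc r)) (suc (suc k))

    pattern α = apex zero
    pattern ξ = vx zero
    pattern a₀ = inAB zero
    pattern a₁ = inAB (suc zero)

    data CoversH : V K → Set where
      inLeg    : ∀ h → CoversH (inH h)
      atCentre : CoversH ξ

    coversH : ∀ {p h} → Covers K p (inH h) → CoversH p
    coversH {inAB _}   (inj₂ ())
    coversH {inS _}    (inj₂ ())
    coversH {inBs _}   (inj₂ ())
    coversH {apex _}   (inj₂ ())
    coversH {inH h} _  = inLeg h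
    coversH {ξ} _      = atCentre

    legH⁺ : ∀ {h g} → Covers (H (suc (suc k))) h g → Covers K (inH h) (inH g)
    legH⁺ = Sum.map (cong (λ h → inH h)) (Equivalence.from T-∨ ∘ inj₁)

    legH⁻ : ∀ {h g} → h ≢ g → Covers K (inH h) (inH g) → Graph.Adj (H (suc (suc k))) h g
    legH⁻ h≢g (inj₁ refl) = contradiction refl h≢g
    legH⁻ {h} {g} h≢g (inj₂ hg) with Equivalence.to (T-∨ {Graph.adj (H (suc (suc k))) h g}) hg
    ... | inj₁ p = p

    αξ-dom : DomPair K α ξ
    αξ-dom (inAB _) = inj₁ (inj₂ tt)
    αξ-dom (inS _)  = inj₁ (inj₂ tt)
    αξ-dom (inBs _) = inj₁ (inj₂ tt)
    αξ-dom α        = inj₁ (inj₁ refl)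
    αξ-dom (inH _)  = inj₂ (inj₂ tt)
    αξ-dom ξ        = inj₂ (inj₁ refl)

    αz-dom : ∀ {h} → Universal (H (suc (suc k))) h → DomPair K α (inH h)
    αz-dom U (inAB _) = inj₁ (inj₂ tt)
    αz-dom U (inS _)  = inj₁ (inj₂ tt)
    αz-dom U (inBs _) = inj₁ (inj₂ tt)
    αz-dom U α        = inj₁ (inj₁ refl)
    αz-dom U (inH g)  = inj₂ (legH⁺ (U g))
    αz-dom U ξ        = inj₂ (inj₂ tt)

    ξa-dom : ∀ {i} → DomPair K ξ (inAB i)
    ξa-dom (inAB _) = inj₁ (inj₂ tt)
    ξa-dom (inS _)  = inj₂ (inj₂ tt)
    ξa-dom (inBs _) = inj₁ (inj₂ tt)
    ξa-dom α        = inj₂ (inj₂ tt)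
    ξa-dom (inH _)  = inj₁ (inj₂ tt)
    ξa-dom ξ        = inj₁ (inj₁ refl)

  F′-Wins₂ : Wins₂ K
  F′-Wins₂ = doubleStar⇒Wins₂ K
    {c = α} {c′ = ξ} {p = inH hub₀} {p′ = inH hub₁} {q = a₀} {q′ = a₁}
    (λ ()) (λ ()) (λ ()) (λ ()) (λ ()) (λ ()) (λ ()) (λ ()) (λ ()) (λ ()) (λ ())
    αξ-dom (αz-dom hub₀-universal) (αz-dom hub₁-universal) ξa-dom ξa-dom

  F′-¬Universal : ∀ u → ¬ Universal K u
  F′-¬Universal u U with coversH (U (inH hub₀))
  ... | inLeg _  = case U α of λ { (inj₁ ()) ; (inj₂ ()) }
  ... | atCentre = case U α of λ { (inj₁ ()) ; (inj₂ ()) }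

  private
    data CoversS : V K → Set where
      inPair : ∀ i → CoversS (inAB i)
      atApex : CoversS α

    -- Two vertices of the part of size $s$ are tested together, since a single one could also be
    -- covered by itself.
    coversS : ∀ {p} → Covers K p (inS zero) → Covers K p (inS (suc zero)) → CoversS p
    coversS {inAB i} _ _ = inPair i
    coversS {inS zero}    _ (inj₂ ())
    coversS {inS (suc _)} (inj₂ ()) _
    coversS {inBs _} (inj₂ ()) _
    coversS {α} _ _ = atApex
    coversS {inH _} (inj₂ ()) _
    coversS {vx _} (inj₂ ()) _

    -- A leg vertex covers neither `a₀`, `a₁` nor the part of size $s$. As `a₀` and `a₁` are not
    -- adjacent, only the apex covers all of these.
    leg-partner : ∀ {p h} → DomPair K (inH h) p → p ≡ α
    leg-partner D with D a₀ | D a₁ | D (inS zero) | D (inS (suc zero))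
    ... | inj₁ (inj₂ ()) | _ | _ | _
    ... | inj₂ _ | inj₁ (inj₂ ()) | _ | _
    ... | inj₂ _ | inj₂ _ | inj₁ (inj₂ ()) | _
    ... | inj₂ _ | inj₂ _ | inj₂ _ | inj₁ (inj₂ ())
    ... | inj₂ c₀ | inj₂ c₁ | inj₂ c | inj₂ c′ with coversS c c′
    ...   | atApex            = refl
    ...   | inPair zero       = case c₁ of λ { (inj₁ ()) ; (inj₂ ()) }
    ...   | inPair (suc zero) = case c₀ of λ { (inj₁ ()) ; (inj₂ ()) }

    meets : ∀ {p q} → DomPair K p q → (p ≡ α ⊎ p ≡ ξ) ⊎ (q ≡ α ⊎ q ≡ ξ)
    meets D with Sum.map coversH coversH (D (inH hub₀))
    ... | inj₁ (inLeg _) = inj₂ (inj₁ (leg-partner D))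
    ... | inj₁ atCentre  = inj₁ (inj₂ refl)
    ... | inj₂ (inLeg _) = inj₁ (inj₁ (leg-partner (DomPair-sym K D)))
    ... | inj₂ atCentre  = inj₂ (inj₂ refl)

    α-partner : ∀ a b {p} → DomPair (deleteEdge K a b) α p → p ≢ ξ → ∃[ h ] p ≡ inH h
    α-partner a b D p≢ξ with D (inH hub₀)
    ... | inj₁ c = case deleteEdge-Covers K a b c of λ { (inj₁ ()) ; (inj₂ ()) }
    ... | inj₂ c with coversH (deleteEdge-Covers K a b c)
    ...   | inLeg h  = h , refl
    ...   | atCentre = contradiction refl p≢ξ

    ξ-partner : ∀ a b {p} → DomPair (deleteEdge K a b) ξ p → p ≢ α → ∃[ i ] p ≡ inAB i
    ξ-partner a b D p≢α with D (inS zero) | D (inS (suc zero))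
    ... | inj₁ c | _ = case deleteEdge-Covers K a b c of λ { (inj₁ ()) ; (inj₂ ()) }
    ... | inj₂ _ | inj₁ c = case deleteEdge-Covers K a b c of λ { (inj₁ ()) ; (inj₂ ()) }
    ... | inj₂ c | inj₂ c′
      with coversS (deleteEdge-Covers K a b c) (deleteEdge-Covers K a b c′)
    ...   | inPair i = i , refl
    ...   | atApex   = contradiction refl p≢α

    -- Staller opens with `ξ`; the partners of `α` lie in the leg and cannot cover a neighbour of
    -- `α`.
    at-α : ∀ y → Graph.Adj K α y → ¬ Wins₂ (deleteEdge K α y)
    at-α y αy = ¬Wins₂-deleteEdge F′-¬Universal meets α y
      λ _ p≢ξ _ _ D _ → let h , eq = α-partner α y D p≢ξ in
        [ (λ c → ⊥-elim (deleteEdge-¬Covers K α y αy c))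
        , (λ c → ⊥-elim (far y αy (subst (λ p → Covers K p y) eq (deleteEdge-Covers K α y c)))) ]′ (D y)
      where
      far : ∀ y {h} → Graph.Adj K α y → ¬ Covers K (inH h) y
      far (inAB _) _ (inj₂ ())
      far (inS _)  _ (inj₂ ())
      far (inBs _) _ (inj₂ ())
      far α ()
      far (inH _) ()
      far (vx _) ()

    meets′ : ∀ {p q} → DomPair K p q → (p ≡ ξ ⊎ p ≡ α) ⊎ (q ≡ ξ ⊎ q ≡ α)
    meets′ D = Sum.map Sum.swap Sum.swap (meets D)

    -- Staller opens with `α`; the partners of `ξ` are among `a₀` and `a₁`, and among the neighbours
    -- of `ξ` each covers only itself. So a partner must equal `y`.
    at-ξ : ∀ y → Graph.Adj K ξ y → ¬ Wins₂ (deleteEdge K ξ y)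
    at-ξ y ξy = ¬Wins₂-deleteEdge F′-¬Universal meets′ ξ y
      λ _ p≢α _ p′≢α D D′ → trans (only p≢α D) (sym (only p′≢α D′))
      where
      near : ∀ y {i} → Graph.Adj K ξ y → Covers K (inAB i) y → inAB i ≡ y
      near (inAB _) _ (inj₁ eq) = eq
      near (inAB _) _ (inj₂ ())
      near (inBs _) _ (inj₂ ())
      near (inH _)  _ (inj₂ ())
      near (inS _) ()
      near (apex _) ()
      near (vx _) ()

      only : ∀ {p} → p ≢ α → DomPair (deleteEdge K ξ y) ξ p → p ≡ y
      only p≢α D with ξ-partner ξ y D p≢α | D y
      ... | _        | inj₁ c = contradiction c (deleteEdge-¬Covers K ξ y ξy)
      ... | _ , refl | inj₂ c = near y ξy (deleteEdge-Covers K ξ y c)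

    ≢-unique : ∀ {i j j′ : Fin 2} → j ≢ i → j′ ≢ i → j ≡ j′
    ≢-unique {zero}     {zero}     j≢i _    = contradiction refl j≢i
    ≢-unique {zero}     {suc zero} {zero} _ j′≢i = contradiction refl j′≢i
    ≢-unique {zero}     {suc zero} {suc zero} _ _ = refl
    ≢-unique {suc zero} {suc zero} j≢i _    = contradiction refl j≢i
    ≢-unique {suc zero} {zero} {suc zero} _ j′≢i = contradiction refl j′≢i
    ≢-unique {suc zero} {zero} {zero} _ _ = refl

    -- Staller opens with `α`. Since `inAB i` no longer covers `inS j`, only the other vertex of the
    -- pair can be a partner of `ξ`.
    pair-S : ∀ i j → ¬ Wins₂ (deleteEdge K (inAB i) (inS j))
    pair-S i j = ¬Wins₂-deleteEdge F′-¬Universal meets′ (inAB i) (inS j) unique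
      where
      K′ = deleteEdge K (inAB i) (inS j)

      ≢i : ∀ {i′} → DomPair K′ ξ (inAB i′) → i′ ≢ i
      ≢i D refl with D (inS j)
      ... | inj₁ c = case deleteEdge-Covers K (inAB i) (inS j) c of λ { (inj₁ ()) ; (inj₂ ()) }
      ... | inj₂ c = deleteEdge-¬Covers K (inAB i) (inS j) tt c

      unique : ∀ {p p′} → p ≢ ξ → p ≢ α → p′ ≢ ξ → p′ ≢ α →
               DomPair K′ ξ p → DomPair K′ ξ p′ → p ≡ p′
      unique _ p≢α _ p′≢α D D′
        with ξ-partner (inAB i) (inS j) D p≢α | ξ-partner (inAB i) (inS j) D′ p′≢α
      ... | _ , refl | _ , refl = cong (λ i → inAB i) (≢-unique (≢i D) (≢i D′))

    leg-leg : ∀ h g → Graph.Adj K (inH h) (inH g) → ¬ Wins₂ (deleteEdge K (inH h) (inH g))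
    leg-leg h g hg = ¬Wins₂-deleteEdge F′-¬Universal meets (inH h) (inH g) unique
      where
      unique : ∀ {p p′} → p ≢ α → p ≢ ξ → p′ ≢ α → p′ ≢ ξ →
               let K′ = deleteEdge K (inH h) (inH g) in
               DomPair K′ α p → DomPair K′ α p′ → p ≡ p′
      unique _ p≢ξ _ p′≢ξ D D′
        with α-partner (inH h) (inH g) D p≢ξ | α-partner (inH h) (inH g) D′ p′≢ξ
      ... | i , refl | j , refl = cong (λ h → inH h)
        (leg-partner-unique K (suc (suc k)) (λ h → inH h) legH⁻
          (λ { (inj₁ ()) ; (inj₂ ()) }) h g hg D D′)

  F′-Minimal : Minimal K
  F′-Minimal α y = at-α y
  F′-Minimal ξ y = at-ξ y
  F′-Minimal (inAB i) (inS j) _ = pair-S i j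
  F′-Minimal (inS j) (inAB i) _ = pair-S i j ∘ Wins₂-deleteEdge-comm _ (inS j) (inAB i)
  F′-Minimal (inH h) (inH g) = leg-leg h g
  F′-Minimal x@(inAB _) α _ = at-α x tt ∘ Wins₂-deleteEdge-comm _ x α
  F′-Minimal x@(inS _)  α _ = at-α x tt ∘ Wins₂-deleteEdge-comm _ x α
  F′-Minimal x@(inBs _) α _ = at-α x tt ∘ Wins₂-deleteEdge-comm _ x α
  F′-Minimal x@(inAB _) ξ _ = at-ξ x tt ∘ Wins₂-deleteEdge-comm _ x ξ
  F′-Minimal x@(inBs _) ξ _ = at-ξ x tt ∘ Wins₂-deleteEdge-comm _ x ξ
  F′-Minimal x@(inH _)  ξ _ = at-ξ x tt ∘ Wins₂-deleteEdge-comm _ x ξ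
  F′-Minimal (inS _)  (inH _) ()
  F′-Minimal (inS _)  (vx _)  ()
  F′-Minimal (inBs _) (inS _) ()
  F′-Minimal (inBs _) (inAB _) ()

-- Criticality in terms of edge-minimality

critical⇒minimal : ∀ {G} → Is2γ′MBCritical G → Minimal G
critical⇒minimal {G} (_ , crit) a b ab = γ′MB>2⇒¬Wins₂ (deleteEdge G a b) a (crit a b ab)

≅-critical : ∀ {G K} → G ≅ K → V K → Wins₂ K → (∀ u → ¬ Universal K u) → Minimal K →
             Is2γ′MBCritical G
≅-critical {G} {K} i v W ¬U min =
  Wins₂⇒γ′MB≡2 G (Inverse.from bijection v) (≅-Wins₂ (≅-sym i) W) (λ u → ¬U _ ∘ ≅-Universal i) ,
  λ a b ab → ¬Wins₂⇒γ′MB>2 (deleteEdge G a b)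
    (min _ _ (subst T (preserves a b) ab) ∘ ≅-Wins₂-deleteEdge i a b)
  where open _≅_ i

∈𝓕⇒critical : ∀ {G} → G ∈𝓕 → Is2γ′MBCritical G
∈𝓕⇒critical record { m₁ = 1 ; m₁≢1 = m₁≢1 } = contradiction refl m₁≢1
∈𝓕⇒critical record { m₁ = 0 ; t = 0 ; 2≤t = 2≤t } with () ← 2≤t refl
∈𝓕⇒critical record { m₁ = 0 ; t = 1 ; 2≤t = 2≤t } with s≤s () ← 2≤t refl
∈𝓕⇒critical record { m₁ = 0 ; t = suc (suc t) ; m₂ = suc (suc k) ; iso = i } =
  ≅-critical i v₁ (F-Wins₂ k (oneLeg t)) (F-¬Universal 0 (suc (suc t)) k) (F-Minimal k (oneLeg t))
∈𝓕⇒critical record { m₁ = suc (suc k₁) ; t = suc t ; m₂ = suc (suc k) ; iso = i } =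
  ≅-critical i v₁ (F-Wins₂ k (twoLegs k₁ t)) (F-¬Universal (suc (suc k₁)) (suc t) k)
             (F-Minimal k (twoLegs k₁ t))
∈𝓕⇒critical record { m₂ = 1 ; 2≤m₂ = s≤s () }

∈𝓕′⇒critical : ∀ {G} → G ∈𝓕′ → Is2γ′MBCritical G
∈𝓕′⇒critical record { s = suc (suc s) ; q = suc (suc q) ; m = suc (suc k) ; iso = i } =
  ≅-critical i (vx zero) (F′-Wins₂ s q k) (F′-¬Universal s q k) (F′-Minimal s q k)
∈𝓕′⇒critical record { s = 1 ; 2≤s = s≤s () }
∈𝓕′⇒critical record { q = 1 ; 2≤q = s≤s () }
∈𝓕′⇒critical record { m = 1 ; 2≤m = s≤s () }

F-∈𝓕 : ∀ {G m₁ t k} → Shape m₁ t → G ≅ F m₁ t (suc (suc k)) → G ∈𝓕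
F-∈𝓕 (oneLeg t) i = record
  { m₁≤m₂ = z≤n ; m₁≢1 = λ () ; 2≤m₂ = s≤s (s≤s z≤n) ; 1≤t = s≤s z≤n
  ; 2≤t = λ _ → s≤s (s≤s z≤n) ; iso = i }
F-∈𝓕 {k = k} (twoLegs k₁ t) i with ℕ.≤-total k₁ k
... | inj₁ k₁≤k = record
  { m₁≤m₂ = s≤s (s≤s k₁≤k) ; m₁≢1 = λ () ; 2≤m₂ = s≤s (s≤s z≤n) ; 1≤t = s≤s z≤n
  ; 2≤t = λ () ; iso = i }
... | inj₂ k≤k₁ = record
  { m₁≤m₂ = s≤s (s≤s k≤k₁) ; m₁≢1 = λ () ; 2≤m₂ = s≤s (s≤s z≤n) ; 1≤t = s≤s z≤n
  ; 2≤t = λ () ; iso = ≅-trans i (F-swap (suc (suc k₁)) (suc t) (suc (suc k))) }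

-- Recognising members of the families

module _ {G : Graph} (min : Minimal G) where
  open Graph G hiding (V)

  Part⇒∈𝓕 : ∀ {m₁ t} k → Shape m₁ t → Part G (F m₁ t (suc (suc k))) (λ _ → ⊤) → G ∈𝓕
  Part⇒∈𝓕 k σ p = F-∈𝓕 σ (Part⇒≅ min (F-Wins₂ k σ) p)

  Part⇒∈𝓕′ : ∀ s r k → 2 ≤ s → Part G (F′ s (suc (suc r)) (suc (suc k))) (λ _ → ⊤) → G ∈𝓕′
  Part⇒∈𝓕′ (suc (suc s)) r k 2≤s p = record
    { 2≤s = 2≤s ; 2≤q = s≤s (s≤s z≤n) ; 2≤m = s≤s (s≤s z≤n)
    ; iso = Part⇒≅ min (F′-Wins₂ s r k) p }
  Part⇒∈𝓕′ (suc zero) _ _ (s≤s ())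

  -- Ingredients of a spanning copy of `F`: centres `c` and `c′`, legs `L₁` and `L₂`, middle part
  -- `B`. `L₂` and `B` may overlap, common vertices going to the leg; hence the middle vertices
  -- supplied below must avoid `L₂`. Hubs are fixed only for `L₂`, as `L₁` may be empty.
  module _ {c c′ : V G} (c≢c′ : c ≢ c′) {L₁ L₂ B : Pred (V G) 0ℓ}
           (L₁? : Decidable L₁) (L₂? : Decidable L₂) (B? : Decidable B)
           (outside : ∀ {v} → v ≡ c ⊎ v ≡ c′ → ¬ L₁ v × ¬ L₂ v × ¬ B v)
           (covered : ∀ {v} → ¬ L₁ v → ¬ L₂ v → ¬ B v → v ≡ c ⊎ v ≡ c′)
           (disjoint : ∀ {v} → L₁ v → ¬ L₂ v × ¬ B v)
           (cL₁ : ∀ {v} → L₁ v → Adj c v) (cB : ∀ {v} → B v → Adj c v)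
           (c′L₂ : ∀ {v} → L₂ v → Adj c′ v) (c′B : ∀ {v} → B v → Adj c′ v)
           {z z′ : V G} (z≢z′ : z ≢ z′) (z∈ : L₂ z) (z′∈ : L₂ z′)
           (z-cov : ∀ {v} → L₂ v → Covers G z v) (z′-cov : ∀ {v} → L₂ v → Covers G z′ v)
    where
    private
      ∉L₁ ∉L₁₂ : Pred (V G) 0ℓ
      ∉L₁ v  = ⊤ × ¬ L₁ v
      ∉L₁₂ v = ∉L₁ v × ¬ L₂ v

      ∉L₁? : Decidable ∉L₁
      ∉L₁? v = yes tt ×-dec ¬? (L₁? v)

      ∉L₁₂? : Decidable ∉L₁₂
      ∉L₁₂? v = ∉L₁? v ×-dec ¬? (L₂? v)

      leg₂ : ∃[ k ] Part G (H (suc (suc k))) (λ v → ∉L₁ v × L₂ v)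
      leg₂ = Part-H (λ v → ∉L₁? v ×-dec L₂? v) z≢z′
        ((tt , λ z∈₁ → proj₁ (disjoint z∈₁) z∈) , z∈)
        ((tt , λ z∈₁ → proj₁ (disjoint z∈₁) z′∈) , z′∈) (z-cov ∘ proj₂) (z′-cov ∘ proj₂)

      middle : ∃[ t ] Part G (edgeless t) (λ v → ∉L₁₂ v × B v)
      middle = Part-edgeless (λ v → ∉L₁₂? v ×-dec B? v)

      centres : Part G (edgeless 2) (λ v → ∉L₁₂ v × ¬ B v)
      centres = Part-two c≢c′ (out (inj₁ refl)) (out (inj₂ refl))
        λ (((_ , ∉₁) , ∉₂) , ∉B) → covered ∉₁ ∉₂ ∉B
        where
        out : ∀ {v} → v ≡ c ⊎ v ≡ c′ → ∉L₁₂ v × ¬ B v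
        out eq = let ∉₁ , ∉₂ , ∉B = outside eq in ((tt , ∉₁) , ∉₂) , ∉B

      whole : ∀ {m₁} → Part G (H m₁) (λ v → ⊤ × L₁ v) →
              Part G (F m₁ (proj₁ middle) (2 + proj₁ leg₂)) (λ _ → ⊤)
      whole {m₁} leg₁ = Part-addEdges parts λ {u} {v} → new u v
        where
        parts = Part-sum false L₁? leg₁
          (Part-sum false L₂? (proj₂ leg₂)
            (Part-sum false B? (proj₂ middle) centres λ ()) λ ()) λ ()

        new : ∀ u v → T (F-new m₁ (proj₁ middle) (2 + proj₁ leg₂) u v) →
              Adj (at parts u) (at parts v)
        new v₁ (inH₁ h) _ = cL₁ (proj₂ (sound leg₁ h))
        new v₂ (inH₂ h) _ = c′L₂ (proj₂ (sound (proj₂ leg₂) h))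
        new v₁ (inB b)  _ = cB (proj₂ (sound (proj₂ middle) b))
        new v₂ (inB b)  _ = c′B (proj₂ (sound (proj₂ middle) b))
        new v₁ (inH₂ _) ()
        new v₂ (inH₁ _) ()

      ∈middle : ∀ {v} → B v → ¬ L₂ v → ∉L₁₂ v × B v
      ∈middle b∈ ∉₂ = ((tt , λ ∈₁ → proj₂ (disjoint ∈₁) b∈) , ∉₂) , b∈

    twoLegs⇒∈𝓕 : ∀ {w w′ b} → w ≢ w′ → L₁ w → L₁ w′ →
      (∀ {v} → L₁ v → Covers G w v) → (∀ {v} → L₁ v → Covers G w′ v) →
      B b → ¬ L₂ b → G ∈𝓕
    twoLegs⇒∈𝓕 w≢w′ w∈ w′∈ w-cov w′-cov b∈ b∉ = Part⇒∈𝓕 (proj₁ leg₂) shape (whole leg₁)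
      where
      legs = Part-H (λ v → yes tt ×-dec L₁? v) w≢w′ (tt , w∈) (tt , w′∈)
                    (w-cov ∘ proj₂) (w′-cov ∘ proj₂)
      leg₁ = proj₂ legs

      shape : Shape (2 + proj₁ legs) (proj₁ middle)
      shape with proj₁ middle | Part⇒1≤ (proj₂ middle) (_ , ∈middle b∈ b∉)
      ... | suc t | _ = twoLegs (proj₁ legs) t

    oneLeg⇒∈𝓕 : ∀ {b b′} → (∀ {v} → ¬ L₁ v) → b ≢ b′ → B b → ¬ L₂ b → B b′ → ¬ L₂ b′ → G ∈𝓕
    oneLeg⇒∈𝓕 ∉L₁ b≢b′ b∈ b∉ b′∈ b′∉ = Part⇒∈𝓕 (proj₁ leg₂) shape (whole none)
      where
      none : Part G (H 0) (λ v → ⊤ × L₁ v)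
      none = record { at = λ () ; at-inj = λ {} ; sound = λ ()
                    ; onto = λ (_ , v∈) → contradiction v∈ ∉L₁ ; hom = λ {} }

      shape : Shape 0 (proj₁ middle)
      shape with proj₁ middle | Part⇒2≤ (proj₂ middle) b≢b′ (∈middle b∈ b∉) (∈middle b′∈ b′∉)
      ... | suc (suc t) | _ = oneLeg t
      ... | suc zero    | s≤s ()

-- Critical graphs with a cut-vertex

module _ {G : Graph} where
  open Graph G hiding (V)

  boundary-edge : ∀ {L : Pred (V G) 0ℓ} → Decidable L → ∀ {u v} → Star Adj u v → L u → ¬ L v →
                  ∃[ a ] ∃[ b ] Adj a b × L a × ¬ L b
  boundary-edge L? ε u∈ v∉ = contradiction u∈ v∉
  boundary-edge L? (_◅_ {j = w} uw path) u∈ v∉ with L? w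
  ... | yes w∈ = boundary-edge L? path w∈ v∉
  ... | no  w∉ = _ , w , uw , u∈ , w∉

module _ {G : Graph} (conn : Connected G) (min : Minimal G) where
  open Graph G hiding (V)

  -- An edge between the two sides could be deleted.
  ¬split : ∀ {L : Pred (V G) 0ℓ} → Decidable L → ∀ {w w′ z z′} →
    w ≢ w′ → L w → L w′ → z ≢ z′ → ¬ L z → ¬ L z′ →
    (∀ {v} → L v → Covers G w v) → (∀ {v} → L v → Covers G w′ v) →
    (∀ {v} → ¬ L v → Covers G z v) → (∀ {v} → ¬ L v → Covers G z′ v) → ⊥
  ¬split {L} L? {w} {w′} {z} {z′} w≢w′ w∈ w′∈ z≢z′ z∉ z′∉ w-cov w′-cov z-cov z′-cov
    with boundary-edge {G} L? (conn w z) w∈ z∉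
  ... | a , b , ab , a∈ , b∉ = min a b ab
    -- Every covering in use stays within one side, so none relies on the crossing edge `ab`. After
    -- its deletion the four pairs still dominate and form a 4-cycle.
    (fourCycle⇒Wins₂ G′ w≢w′ z≢z′ (≢ w∈ z∉) (≢ w∈ z′∉) (≢ w′∈ z∉) (≢ w′∈ z′∉)
      (dom w∈ z∉ w-cov z-cov) (dom w∈ z′∉ w-cov z′-cov)
      (dom w′∈ z∉ w′-cov z-cov) (dom w′∈ z′∉ w′-cov z′-cov))
    where
    G′ = deleteEdge G a b

    ≢ : ∀ {u v} → L u → ¬ L v → u ≢ v
    ≢ u∈ v∉ refl = v∉ u∈

    dom : ∀ {u v} → L u → ¬ L v → (∀ {y} → L y → Covers G u y) →
          (∀ {y} → ¬ L y → Covers G v y) → DomPair G′ u v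
    dom u∈ v∉ u-cov v-cov y with L? y
    ... | yes y∈ = inj₁ (Sum.map₂ (λ uy → deleteEdge⁺ G a b uy λ
                     { (inj₁ (_ , refl)) → b∉ y∈ ; (inj₂ (refl , _)) → b∉ u∈ }) (u-cov y∈))
    ... | no  y∉ = inj₂ (Sum.map₂ (λ vy → deleteEdge⁺ G a b vy λ
                     { (inj₁ (refl , _)) → v∉ a∈ ; (inj₂ (_ , refl)) → y∉ a∈ }) (v-cov y∉))

-- The two sides of $G - x$

module _ {G : Graph} {x : V G} (cut : IsCutVertex G x) where
  open Graph G hiding (V)
  private
    Path : ∀ {u v} → u ≢ x → v ≢ x → Set
    Path {u} {v} u≢x v≢x = Star (Graph.Adj (deleteVertex G x)) (u , u≢x) (v , v≢x)

    step : ∀ {u v} (u≢x : u ≢ x) (v≢x : v ≢ x) → Covers G u v → Path u≢x v≢x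
    step _ _ (inj₁ refl) = ε
    step _ _ (inj₂ uv)   = uv ◅ ε

    back : ∀ {u v} {u≢x : u ≢ x} {v≢x : v ≢ x} → Path u≢x v≢x → Path v≢x u≢x
    back = reverse (Adj-sym G)

  -- Every vertex is covered by `d` or `e`, so a path between them avoiding `x` would connect all of
  -- $G - x$. With `d` and `e` equal this excludes a universal vertex other than `x`.
  ¬linked : ∀ {d e} (d≢x : d ≢ x) (e≢x : e ≢ x) → DomPair G d e → ¬ Path d≢x e≢x
  ¬linked {d} {e} d≢x e≢x D d⇝e = cut λ (u , u≢x) (v , v≢x) → back (reach u≢x) ◅◅ reach v≢x
    where
    reach : ∀ {v} (v≢x : v ≢ x) → Path d≢x v≢x
    reach {v} v≢x with D v
    ... | inj₁ c = step d≢x v≢x c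
    ... | inj₂ c = d⇝e ◅◅ step e≢x v≢x c

  module _ {c : V G} (c≢x : c ≢ x) (φ : Fork G x c) where
    open Fork φ using () renaming
      (e₁ to w; e₂ to w′; e₁≢e₂ to w≢w′; e₁≢s to w≢x; e₂≢s to w′≢x; dom₁ to cw; dom₂ to cw′)

    -- The two sides of G − x, and the vertices that dominate their own side.
    In₁ In₂ U₁ U₂ : Pred (V G) 0ℓ
    In₁ v = v ≢ x × Covers G c v
    In₂ v = v ≢ x × ¬ Covers G c v
    U₁ p  = In₁ p × (∀ {v} → In₁ v → Covers G p v)
    U₂ p  = In₂ p × (∀ {v} → In₂ v → Covers G p v)

    In₁? : Decidable In₁
    In₁? v = ¬? (v ≟ x) ×-dec covers? G c v

    In₂? : Decidable In₂
    In₂? v = ¬? (v ≟ x) ×-dec ¬? (covers? G c v)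

    side : ∀ {v} → v ≢ x → In₁ v ⊎ In₂ v
    side {v} v≢x with covers? G c v
    ... | yes cv = inj₁ (v≢x , cv)
    ... | no ¬cv = inj₂ (v≢x , ¬cv)

    ∉₂⇒ : ∀ {v} → ¬ In₂ v → v ≡ x ⊎ In₁ v
    ∉₂⇒ {v} v∉₂ with v ≟ x
    ... | yes v≡x = inj₁ v≡x
    ... | no  v≢x = inj₂ ([ id , ⊥-elim ∘ v∉₂ ]′ (side v≢x))

    ∉₁⇒ : ∀ {v} → ¬ In₁ v → v ≡ x ⊎ In₂ v
    ∉₁⇒ {v} v∉₁ with v ≟ x
    ... | yes v≡x = inj₁ v≡x
    ... | no  v≢x = inj₂ ([ ⊥-elim ∘ v∉₁ , id ]′ (side v≢x))

    -- `w` covers what `c` does not, so a covering across the sides would give a path from `c` to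
    -- `w` in $G - x$.
    separated : ∀ {u v} → In₁ u → In₂ v → ¬ Covers G u v
    separated {u} {v} (u≢x , cu) (v≢x , ¬cv) uv with cw v
    ... | inj₁ cv = ¬cv cv
    ... | inj₂ wv = ¬linked c≢x w≢x cw
      (step c≢x u≢x cu ◅◅ step u≢x v≢x uv ◅◅ step v≢x w≢x (Covers-sym G wv))

    c∈U₁ : U₁ c
    c∈U₁ = (c≢x , inj₁ refl) , proj₂

    private
      partner∈U₂ : ∀ {p} → p ≢ x → DomPair G c p → U₂ p
      partner∈U₂ p≢x cp = (p≢x , ¬linked c≢x p≢x cp ∘ step c≢x p≢x) ,
        λ (_ , ¬cv) → [ ⊥-elim ∘ ¬cv , id ]′ (cp _)

    w∈U₂ : U₂ w
    w∈U₂ = partner∈U₂ w≢x cw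

    w′∈U₂ : U₂ w′
    w′∈U₂ = partner∈U₂ w′≢x cw′

    -- If both members lay on one side, `w` or `c` on the other would stay uncovered. With one
    -- member on each side, separation makes each responsible for its whole side.
    domPair-split : ∀ {p r} → DomPair G p r → p ≢ x → r ≢ x → (U₁ p × U₂ r) ⊎ (U₂ p × U₁ r)
    domPair-split D p≢x r≢x with side p≢x | side r≢x
    ... | inj₁ p∈ | inj₁ r∈ = ⊥-elim ([ separated p∈ (proj₁ w∈U₂) , separated r∈ (proj₁ w∈U₂) ]′ (D w))
    ... | inj₂ p∈ | inj₂ r∈ = ⊥-elim
      ([ separated (proj₁ c∈U₁) p∈ ∘ Covers-sym G , separated (proj₁ c∈U₁) r∈ ∘ Covers-sym G ]′ (D c))
    ... | inj₁ p∈ | inj₂ r∈ = inj₁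
      ( (p∈ , λ v∈ → [ id , ⊥-elim ∘ separated v∈ r∈ ∘ Covers-sym G ]′ (D _))
      , (r∈ , λ v∈ → [ ⊥-elim ∘ separated p∈ v∈ , id ]′ (D _)))
    ... | inj₂ p∈ | inj₁ r∈ = inj₂
      ( (p∈ , λ v∈ → [ id , ⊥-elim ∘ separated r∈ v∈ ]′ (D _))
      , (r∈ , λ v∈ → [ ⊥-elim ∘ separated v∈ p∈ ∘ Covers-sym G , id ]′ (D _)))

    fork-split : ∀ {s d} (ψ : Fork G s d) → let open Fork ψ in d ≢ x → e₁ ≢ x → e₂ ≢ x →
      (U₁ d × U₂ e₁ × U₂ e₂) ⊎ (U₂ d × U₁ e₁ × U₁ e₂)
    fork-split ψ d≢x e₁≢x e₂≢x
      with domPair-split (Fork.dom₁ ψ) d≢x e₁≢x | domPair-split (Fork.dom₂ ψ) d≢x e₂≢x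
    ... | inj₁ (d∈ , e₁∈) | inj₁ (_ , e₂∈) = inj₁ (d∈ , e₁∈ , e₂∈)
    ... | inj₂ (d∈ , e₁∈) | inj₂ (_ , e₂∈) = inj₂ (d∈ , e₁∈ , e₂∈)
    ... | inj₁ (((_ , cd) , _) , _) | inj₂ (((_ , ¬cd) , _) , _) = contradiction cd ¬cd
    ... | inj₂ (((_ , ¬cd) , _) , _) | inj₁ (((_ , cd) , _) , _) = contradiction cd ¬cd

    -- `x` must be covered in both pairs: either `d` does it, or both partners do.
    fork-x : ∀ {s d} (ψ : Fork G s d) → let open Fork ψ in d ≢ x → e₁ ≢ x → e₂ ≢ x →
      Adj d x ⊎ (Adj e₁ x × Adj e₂ x)
    fork-x ψ d≢x e₁≢x e₂≢x with Fork.dom₁ ψ x | Fork.dom₂ ψ x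
    ... | inj₁ (inj₁ eq) | _ = contradiction eq d≢x
    ... | inj₁ (inj₂ dx) | _ = inj₁ dx
    ... | inj₂ _ | inj₁ (inj₁ eq) = contradiction eq d≢x
    ... | inj₂ _ | inj₁ (inj₂ dx) = inj₁ dx
    ... | inj₂ (inj₁ eq) | inj₂ _ = contradiction eq e₁≢x
    ... | inj₂ (inj₂ _)  | inj₂ (inj₁ eq) = contradiction eq e₂≢x
    ... | inj₂ (inj₂ e₁x) | inj₂ (inj₂ e₂x) = inj₂ (e₁x , e₂x)

    module _ (conn : Connected G) (min : Minimal G) where

      -- The case of `¬split` in which `x` joins the first side; `w` and `w′` always serve the
      -- second one.
      ¬x-with₁ : ∀ {p p′} → p ≢ p′ → ¬ In₂ p → ¬ In₂ p′ →
        (∀ {v} → ¬ In₂ v → Covers G p v) → (∀ {v} → ¬ In₂ v → Covers G p′ v) → ⊥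
      ¬x-with₁ p≢p′ p∉ p′∉ p-cov p′-cov =
        ¬split conn min {L = λ v → ¬ In₂ v} (λ v → ¬? (In₂? v)) p≢p′ p∉ p′∉
          w≢w′ (λ ∉₂ → ∉₂ (proj₁ w∈U₂)) (λ ∉₂ → ∉₂ (proj₁ w′∈U₂))
          p-cov p′-cov (proj₂ w∈U₂ ∘ stable) (proj₂ w′∈U₂ ∘ stable)
        where
        stable : ∀ {v} → ¬ ¬ In₂ v → In₂ v
        stable {v} = decidable-stable (In₂? v)

      ¬twins₁-adj : ∀ {p p′} → p ≢ p′ → U₁ p → U₁ p′ → Adj p x → Adj p′ x → ⊥
      ¬twins₁-adj p≢p′ p∈ p′∈ px p′x =
        ¬x-with₁ p≢p′ (∉₂ p∈) (∉₂ p′∈) (cov p∈ px) (cov p′∈ p′x)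
        where
        ∉₂ : ∀ {p} → U₁ p → ¬ In₂ p
        ∉₂ ((_ , cp) , _) (_ , ¬cp) = ¬cp cp

        cov : ∀ {p} → U₁ p → Adj p x → ∀ {v} → ¬ In₂ v → Covers G p v
        cov (_ , p-cov) px v∉ = [ (λ { refl → inj₂ px }) , p-cov ]′ (∉₂⇒ v∉)

      -- Now `x` joins the second side, so two dominating vertices have to be provided on each side.
      ¬twins-adj₂ : ∀ {p p′ r r′} → p ≢ p′ → U₁ p → U₁ p′ →
                    r ≢ r′ → U₂ r → U₂ r′ → Adj r x → Adj r′ x → ⊥
      ¬twins-adj₂ p≢p′ p∈ p′∈ r≢r′ r∈ r′∈ rx r′x =
        ¬split conn min In₁? p≢p′ (proj₁ p∈) (proj₁ p′∈) r≢r′ (∉₁ r∈) (∉₁ r′∈)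
          (proj₂ p∈) (proj₂ p′∈) (cov r∈ rx) (cov r′∈ r′x)
        where
        ∉₁ : ∀ {r} → U₂ r → ¬ In₁ r
        ∉₁ ((_ , ¬cr) , _) (_ , cr) = ¬cr cr

        cov : ∀ {r} → U₂ r → Adj r x → ∀ {v} → ¬ In₁ v → Covers G r v
        cov (_ , r-cov) rx v∉ = [ (λ { refl → inj₂ rx }) , r-cov ]′ (∉₁⇒ v∉)

      -- Otherwise `c` and `x` would both dominate the first side together with `x`.
      ¬x-covers₁ : (∀ {v} → In₁ v → Covers G x v) → ⊥
      ¬x-covers₁ x-cov = ¬x-with₁ c≢x (λ (_ , ¬cc) → ¬cc (inj₁ refl)) (λ (x≢x , _) → x≢x refl)
        (λ v∉ → [ (λ { refl → Covers-sym G (x-cov (proj₁ c∈U₁)) }) , proj₂ ]′ (∉₂⇒ v∉))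
        (λ v∉ → [ (λ v≡x → inj₁ (sym v≡x)) , x-cov ]′ (∉₂⇒ v∉))

      ¬universal : ∀ {u} → ¬ Universal G u
      ¬universal {u} U with u ≟ x
      ... | yes refl = ¬x-covers₁ λ _ → U _
      ... | no  u≢x  = ¬linked u≢x u≢x (inj₁ ∘ U) ε

      -- A partner on the second side would leave the whole first side to `x`.
      x-pair∈₁ : ∀ {y} → DomPair G x y → y ≢ x → In₁ y
      x-pair∈₁ D y≢x with side y≢x
      ... | inj₁ y∈ = y∈
      ... | inj₂ y∈ = ⊥-elim (¬x-covers₁ λ v∈ →
        [ id , ⊥-elim ∘ separated v∈ y∈ ∘ Covers-sym G ]′ (D _))

      x-pair-adj₂ : ∀ {y} → DomPair G x y → y ≢ x → ∀ {v} → In₂ v → Adj x v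
      x-pair-adj₂ D y≢x {v} v∈ with D v
      ... | inj₁ (inj₁ refl) = contradiction refl (proj₁ v∈)
      ... | inj₁ (inj₂ xv)   = xv
      ... | inj₂ yv          = ⊥-elim (separated (x-pair∈₁ D y≢x) v∈ yv)

      -- The partner of `x` lies on the first side, so `x` is adjacent to the entire second side, in
      -- particular to `w` and `w′`. A second vertex dominating the first side then gives a
      -- forbidden split.
      ¬twin-x-pair : ∀ {p y} → c ≢ p → U₁ p → DomPair G x y → y ≢ x → ⊥
      ¬twin-x-pair c≢p p∈ D y≢x = ¬twins-adj₂ c≢p c∈U₁ p∈ w≢w′ w∈U₂ w′∈U₂
        (Adj-sym G (x-pair-adj₂ D y≢x (proj₁ w∈U₂))) (Adj-sym G (x-pair-adj₂ D y≢x (proj₁ w′∈U₂)))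

      In₁-adj : ∀ {v} → In₁ v → v ≢ c → Adj c v
      In₁-adj (_ , inj₁ c≡v) v≢c = contradiction (sym c≡v) v≢c
      In₁-adj (_ , inj₂ cv)  _   = cv

      -- Opening `c` answered by the cut-vertex

      module _ {e e′ : V G} (e≢e′ : e ≢ e′) (e≢x : e ≢ x) (e′≢x : e′ ≢ x)
               (e≢c : e ≢ c) (e′≢c : e′ ≢ c) (xe : DomPair G x e) (xe′ : DomPair G x e′) where

        private
          x-adj₂ : ∀ {v} → In₂ v → Adj x v
          x-adj₂ = x-pair-adj₂ xe e≢x

          Rest : Pred (V G) 0ℓ
          Rest v = In₁ v × v ≢ c

          Rest? : Decidable Rest
          Rest? v = In₁? v ×-dec ¬? (v ≟ c)

          rest∉₂ : ∀ {v} → Rest v → ¬ In₂ v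
          rest∉₂ ((_ , cv) , _) (_ , ¬cv) = ¬cv cv

          e∈ : Rest e
          e∈ = x-pair∈₁ xe e≢x , e≢c

          e′∈ : Rest e′
          e′∈ = x-pair∈₁ xe′ e′≢x , e′≢c

          x-pair-cov : ∀ {p v} → DomPair G x p → Rest v → ¬ Adj x v → Covers G p v
          x-pair-cov {v = v} D ((v≢x , _) , _) ¬xv with D v
          ... | inj₁ (inj₁ refl) = contradiction refl v≢x
          ... | inj₁ (inj₂ xv)   = contradiction xv ¬xv
          ... | inj₂ pv          = pv

          ¬cx-rest : ∀ {v} → v ≡ c ⊎ v ≡ x → ¬ Rest v
          ¬cx-rest (inj₁ refl) (_ , v≢c)       = v≢c refl
          ¬cx-rest (inj₂ refl) ((x≢x , _) , _) = x≢x refl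

          ¬cx∈₂ : ∀ {v} → v ≡ c ⊎ v ≡ x → ¬ In₂ v
          ¬cx∈₂ (inj₁ refl) (_ , ¬cc)  = ¬cc (inj₁ refl)
          ¬cx∈₂ (inj₂ refl) (x≢x , _) = x≢x refl

          remaining : ∀ {v} → ¬ Rest v → ¬ In₂ v → v ≡ c ⊎ v ≡ x
          remaining {v} v∉ v∉₂ with v ≟ c | ∉₂⇒ v∉₂
          ... | yes v≡c | _        = inj₁ v≡c
          ... | no  _   | inj₁ v≡x = inj₂ v≡x
          ... | no  v≢c | inj₂ v∈  = contradiction (v∈ , v≢c) v∉

        -- The centres are `c` and `x`. The first leg consists of the hubs `h`, `h′` and the
        -- vertices of `Rest` not adjacent to `x`; the other vertices of `Rest` form the middle, and
        -- the second side is the second leg.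
        clique-hubs⇒∈𝓕 : ∀ {h h′} → Rest h → Rest h′ → Adj h h′ →
          (∀ {v} → Rest v → ¬ Adj x v → Covers G h v) →
          (∀ {v} → Rest v → ¬ Adj x v → Covers G h′ v) → G ∈𝓕
        clique-hubs⇒∈𝓕 {h} {h′} h∈ h′∈ hh′ h-cov h′-cov = result
          where
          h≢h′ : h ≢ h′
          h≢h′ = Adj⇒≢ G hh′

          Leg Mid : Pred (V G) 0ℓ
          Leg v = Rest v × (¬ Adj x v ⊎ (v ≡ h ⊎ v ≡ h′))
          Mid v = Rest v × ¬ (¬ Adj x v ⊎ (v ≡ h ⊎ v ≡ h′))

          leg? : Decidable (λ v → ¬ Adj x v ⊎ (v ≡ h ⊎ v ≡ h′))
          leg? v = ¬? (T? (adj x v)) ⊎-dec ((v ≟ h) ⊎-dec (v ≟ h′))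

          Mid? : Decidable Mid
          Mid? v = Rest? v ×-dec ¬? (leg? v)

          Leg-cov : ∀ {v} → Leg v → Covers G h v
          Leg-cov (v∈ , inj₁ ¬xv)         = h-cov v∈ ¬xv
          Leg-cov (_ , inj₂ (inj₁ refl)) = inj₁ refl
          Leg-cov (_ , inj₂ (inj₂ refl)) = inj₂ hh′

          Leg-cov′ : ∀ {v} → Leg v → Covers G h′ v
          Leg-cov′ (v∈ , inj₁ ¬xv)         = h′-cov v∈ ¬xv
          Leg-cov′ (_ , inj₂ (inj₁ refl)) = inj₂ (Adj-sym G hh′)
          Leg-cov′ (_ , inj₂ (inj₂ refl)) = inj₁ refl

          result : G ∈𝓕
          result with Game.∃? G Mid?
          ... | yes (b , b∈) = twoLegs⇒∈𝓕 min c≢x (λ v → Rest? v ×-dec leg? v) In₂? Mid?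
            (λ eq → ¬cx-rest eq ∘ proj₁ , ¬cx∈₂ eq , ¬cx-rest eq ∘ proj₁)
            (λ {v} ∉L ∉₂ ∉M → remaining (λ v∈ → ∉M (v∈ , λ l → ∉L (v∈ , l))) ∉₂)
            (λ (v∈ , l) → rest∉₂ v∈ , λ (_ , ¬l) → ¬l l)
            (λ ((v∈ , v≢c) , _) → In₁-adj v∈ v≢c) (λ ((v∈ , v≢c) , _) → In₁-adj v∈ v≢c)
            x-adj₂ (λ (_ , ¬l) → decidable-stable (T? _) (¬l ∘ inj₁))
            w≢w′ (proj₁ w∈U₂) (proj₁ w′∈U₂) (proj₂ w∈U₂) (proj₂ w′∈U₂)
            h≢h′ (h∈ , inj₂ (inj₁ refl)) (h′∈ , inj₂ (inj₂ refl)) Leg-cov Leg-cov′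
            b∈ (rest∉₂ (proj₁ b∈))
          -- With an empty middle, `h` and `h′` dominate the first side, while `w` and `w′` are
          -- adjacent to `x`: a forbidden split.
          ... | no ¬mid = ⊥-elim (¬twins-adj₂ h≢h′ (U h∈ Leg-cov) (U h′∈ Leg-cov′) w≢w′ w∈U₂ w′∈U₂
            (Adj-sym G (x-adj₂ (proj₁ w∈U₂))) (Adj-sym G (x-adj₂ (proj₁ w′∈U₂))))
            where
            U : ∀ {p} → Rest p → (∀ {v} → Leg v → Covers G p v) → U₁ p
            U (p∈ , p≢c) cov = p∈ , covU
              where
              covU : ∀ {v} → In₁ v → Covers G _ v
              covU {v} v∈ with v ≟ c | leg? v
              ... | yes refl | _      = Covers-sym G (proj₂ p∈)
              ... | no  v≢c  | yes l  = cov ((v∈ , v≢c) , l)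
              ... | no  v≢c  | no  ¬l = contradiction (v , (v∈ , v≢c) , ¬l) ¬mid

        -- There is no first leg: all of `Rest` is the middle, and `e`, `e′` show that it has at
        -- least two vertices.
        x-adj-rest⇒∈𝓕 : (∀ {v} → Rest v → Adj x v) → G ∈𝓕
        x-adj-rest⇒∈𝓕 x-adj = oneLeg⇒∈𝓕 min c≢x {L₁ = λ _ → ⊥} (λ _ → no id) In₂? Rest?
          (λ eq → id , ¬cx∈₂ eq , ¬cx-rest eq) (λ _ ∉₂ ∉R → remaining ∉R ∉₂) (λ ())
          (λ ()) (λ (v∈ , v≢c) → In₁-adj v∈ v≢c) x-adj₂ x-adj
          w≢w′ (proj₁ w∈U₂) (proj₁ w′∈U₂) (proj₂ w∈U₂) (proj₂ w′∈U₂)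
          id e≢e′ e∈ (rest∉₂ e∈) e′∈ (rest∉₂ e′∈)

        two-far⇒∈𝓕′ : ∀ {y y′} → Adj x e → Adj x e′ → y ≢ y′ →
          Rest y → ¬ Adj x y → Rest y′ → ¬ Adj x y′ → G ∈𝓕′
        two-far⇒∈𝓕′ {y} {y′} xe∈ xe′∈ y≢y′ y∈ ¬xy y′∈ ¬xy′ = result
          where
          A₁ A₂ A₃ A₄ : Pred (V G) 0ℓ
          A₁ v = ⊤ × In₁ v
          A₂ v = A₁ v × v ≢ c
          Inner : Pred (V G) 0ℓ
          Inner v = (v ≡ e ⊎ v ≡ e′) ⊎ ¬ Adj x v
          A₃ v = A₂ v × Inner v
          A₄ v = ⊤ × ¬ In₁ v

          hub? : Decidable (λ v → v ≡ e ⊎ v ≡ e′)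
          hub? v = (v ≟ e) ⊎-dec (v ≟ e′)

          Inner? : Decidable Inner
          Inner? v = hub? v ⊎-dec ¬? (T? (adj x v))

          A₂? : Decidable A₂
          A₂? v = (yes tt ×-dec In₁? v) ×-dec ¬? (v ≟ c)

          A₃? : Decidable A₃
          A₃? v = A₂? v ×-dec Inner? v

          apexPart : Part G (complete 1) (λ v → A₁ v × v ≡ c)
          apexPart = Part-complete (Part-one ((tt , proj₁ c∈U₁) , refl) proj₂)
            λ (_ , u≡c) (_ , v≡c) u≢v → contradiction (trans u≡c (sym v≡c)) u≢v

          hubs : Part G (edgeless 2) (λ v → A₃ v × (v ≡ e ⊎ v ≡ e′))
          hubs = Part-two e≢e′ (at-hub e∈ (inj₁ refl)) (at-hub e′∈ (inj₂ refl)) proj₂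
            where
            at-hub : ∀ {v} → Rest v → v ≡ e ⊎ v ≡ e′ → A₃ v × (v ≡ e ⊎ v ≡ e′)
            at-hub (v∈ , v≢c) h = (((tt , v∈) , v≢c) , inj₁ h) , h

          far : ∃[ s ] Part G (edgeless s) (λ v → A₃ v × ¬ (v ≡ e ⊎ v ≡ e′))
          far = Part-edgeless (λ v → A₃? v ×-dec ¬? (hub? v))

          far∈ : ∀ {v} → Rest v → ¬ Adj x v → A₃ v × ¬ (v ≡ e ⊎ v ≡ e′)
          far∈ (v∈ , v≢c) ¬xv = (((tt , v∈) , v≢c) , inj₂ ¬xv) ,
            λ { (inj₁ refl) → ¬xv xe∈ ; (inj₂ refl) → ¬xv xe′∈ }

          near : ∃[ r ] Part G (edgeless r) (λ v → A₂ v × ¬ Inner v)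
          near = Part-edgeless (λ v → A₂? v ×-dec ¬? (Inner? v))

          legPart : ∃[ k ] Part G (H (suc (suc k))) (λ v → A₄ v × In₂ v)
          legPart = Part-H (λ v → (yes tt ×-dec ¬? (In₁? v)) ×-dec In₂? v) w≢w′
            (in₂ (proj₁ w∈U₂)) (in₂ (proj₁ w′∈U₂)) (proj₂ w∈U₂ ∘ proj₂) (proj₂ w′∈U₂ ∘ proj₂)
            where
            in₂ : ∀ {v} → In₂ v → A₄ v × In₂ v
            in₂ v∈₂@(_ , ¬cv) = (tt , λ (_ , cv) → ¬cv cv) , v∈₂

          xPart : Part G (edgeless 1) (λ v → A₄ v × ¬ In₂ v)
          xPart = Part-one ((tt , λ (x≢x , _) → x≢x refl) , λ (x≢x , _) → x≢x refl)
            λ ((_ , ∉₁) , ∉₂) → [ id , ⊥-elim ∘ ∉₁ ]′ (∉₂⇒ ∉₂)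

          hub-cov : ∀ {v z} → z ≡ e ⊎ z ≡ e′ → A₃ v → ¬ (v ≡ e ⊎ v ≡ e′) → Adj z v
          hub-cov _ (_ , inj₁ h) ¬h = contradiction h ¬h
          hub-cov (inj₁ refl) (((_ , v∈) , v≢c) , inj₂ ¬xv) ¬h =
            [ (λ eq → contradiction (inj₁ (sym eq)) ¬h) , id ]′ (x-pair-cov xe (v∈ , v≢c) ¬xv)
          hub-cov (inj₂ refl) (((_ , v∈) , v≢c) , inj₂ ¬xv) ¬h =
            [ (λ eq → contradiction (inj₂ (sym eq)) ¬h) , id ]′ (x-pair-cov xe′ (v∈ , v≢c) ¬xv)

          s r k : ℕ
          s = proj₁ far
          r = proj₁ near
          k = proj₁ legPart

          parts : Part G (F′-parts s (suc (suc r)) (suc (suc k))) (λ _ → ⊤)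
          parts = Part-sum false In₁?
            (Part-sum true (_≟ c) apexPart
              (Part-sum false Inner?
                (Part-sum true hub? hubs (proj₂ far) λ _ _ h v∈ ¬h → hub-cov h v∈ ¬h)
                (proj₂ near) λ ())
              λ { _ _ refl (_ , v∈) v≢c → In₁-adj v∈ v≢c })
            (Part-sum false In₂? (proj₂ legPart) xPart λ ()) λ ()

          new : ∀ u v → T (F′-new s (suc (suc r)) (suc (suc k)) u v) → Adj (at parts u) (at parts v)
          new (vx _) (inH h)  _ = x-adj₂ (proj₂ (sound (proj₂ legPart) h))
          new (vx _) (inAB i) _ with sound hubs i
          ... | _ , inj₁ eq = subst (Adj x) (sym eq) xe∈
          ... | _ , inj₂ eq = subst (Adj x) (sym eq) xe′∈
          new (vx _) (inBs i) _ =
            decidable-stable (T? _) λ ¬xv → proj₂ (sound (proj₂ near) i) (inj₂ ¬xv)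
          new (vx _) (inS _)  ()
          new (vx _) (apex _) ()
          new (vx _) (vx _)   ()

          whole : Part G (F′ s (suc (suc r)) (suc (suc k))) (λ _ → ⊤)
          whole = Part-addEdges parts λ {u} {v} → new u v

          2≤s : 2 ≤ s
          2≤s = Part⇒2≤ (proj₂ far) y≢y′ (far∈ y∈ ¬xy) (far∈ y′∈ ¬xy′)

          result : G ∈𝓕′
          result = Part⇒∈𝓕′ min s r k 2≤s whole

        -- If `e` and `e′` are adjacent, they are hubs of a first leg. Otherwise the number of
        -- vertices of `Rest` not adjacent to `x` decides: none gives one leg, exactly one gives a
        -- leg with hubs `y` and `e`, and two or more give `F′`.
        x-fork⇒∈𝓕∪𝓕′ : G ∈𝓕 ⊎ G ∈𝓕′
        x-fork⇒∈𝓕∪𝓕′ with T? (adj e e′)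
        ... | yes ee′ = inj₁ (clique-hubs⇒∈𝓕 e∈ e′∈ ee′ (x-pair-cov xe) (x-pair-cov xe′))
        ... | no ¬ee′ with Game.∃? G (λ v → Rest? v ×-dec ¬? (T? (adj x v)))
        ...   | no ¬far = inj₁ (x-adj-rest⇒∈𝓕 λ {v} v∈ →
                  decidable-stable (T? _) λ ¬xv → ¬far (v , v∈ , ¬xv))
        ...   | yes (y , y∈ , ¬xy)
          with Game.∃? G (λ v → (Rest? v ×-dec ¬? (T? (adj x v))) ×-dec ¬? (y ≟ v))
        ...     | yes (y′ , (y′∈ , ¬xy′) , y≢y′) =
                    inj₂ (two-far⇒∈𝓕′ x-adj-e x-adj-e′ y≢y′ y∈ ¬xy y′∈ ¬xy′)
          where
          x-adj-e : Adj x e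
          -- Were `e` not adjacent to `x`, its covering would fall to `e′`, which is neither equal
          -- nor adjacent to `e`.
          x-adj-e = decidable-stable (T? _) λ ¬xe →
            [ e≢e′ ∘ sym , ¬ee′ ∘ Adj-sym G ]′ (x-pair-cov xe′ e∈ ¬xe)
          x-adj-e′ : Adj x e′
          x-adj-e′ = decidable-stable (T? _) λ ¬xe′ → [ e≢e′ , ¬ee′ ]′ (x-pair-cov xe e′∈ ¬xe′)
        ...     | no only = inj₁ (clique-hubs⇒∈𝓕 y∈ e∈
          -- `e` covers `y`, so the two are adjacent unless equal; equality is impossible because
          -- `e′` must cover `y` as well.
          ([ (λ { refl → ⊥-elim ([ e≢e′ ∘ sym , ¬ee′ ∘ Adj-sym G ]′ (x-pair-cov xe′ e∈ ¬xy)) })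
           , Adj-sym G ]′ (x-pair-cov xe y∈ ¬xy))
          (λ {v} v∈ ¬xv → inj₁ (decidable-stable (y ≟ v) λ y≢v → only (v , (v∈ , ¬xv) , y≢v)))
          (x-pair-cov xe))

      -- Here x itself is the only vertex of the middle part B.
      bridge⇒∈𝓕 : ∀ {d e e′ f f′} → U₂ d → Adj c x → Adj d x →
        e ≢ e′ → U₁ e → U₁ e′ → e ≢ c → e′ ≢ c →
        f ≢ f′ → U₂ f → U₂ f′ → f ≢ d → f′ ≢ d → G ∈𝓕
      bridge⇒∈𝓕 {d} ((d≢x , ¬cd) , d-cov) cx dx e≢e′ e∈ e′∈ e≢c e′≢c f≢f′ f∈ f′∈ f≢d f′≢d =
        twoLegs⇒∈𝓕 min {c} {d} (λ c≡d → ¬cd (inj₁ c≡d))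
          (λ v → In₁? v ×-dec ¬? (v ≟ c)) (λ v → In₂? v ×-dec ¬? (v ≟ d)) (_≟ x)
          (λ { (inj₁ refl) → (λ (_ , c≢c) → c≢c refl) , (λ ((_ , ¬cc) , _) → ¬cc (inj₁ refl)) , c≢x
             ; (inj₂ refl) → (λ ((_ , cd) , _) → ¬cd cd) , (λ (_ , d≢d) → d≢d refl) , d≢x })
          (λ ∉₁ ∉₂ v≢x → centre ∉₁ ∉₂ (side v≢x))
          (λ ((v≢x , cv) , _) → (λ ((_ , ¬cv) , _) → ¬cv cv) , v≢x)
          (λ (v∈ , v≢c) → In₁-adj v∈ v≢c) (λ { refl → cx })
          (λ (v∈ , v≢d) → [ (λ d≡v → contradiction (sym d≡v) v≢d) , id ]′ (d-cov v∈))
          (λ { refl → dx })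
          f≢f′ (proj₁ f∈ , f≢d) (proj₁ f′∈ , f′≢d) (proj₂ f∈ ∘ proj₁) (proj₂ f′∈ ∘ proj₁)
          e≢e′ (proj₁ e∈ , e≢c) (proj₁ e′∈ , e′≢c) (proj₂ e∈ ∘ proj₁) (proj₂ e′∈ ∘ proj₁)
          refl (λ ((x≢x , _) , _) → x≢x refl)
        where
        centre : ∀ {v} → ¬ (In₁ v × v ≢ c) → ¬ (In₂ v × v ≢ d) → In₁ v ⊎ In₂ v → v ≡ c ⊎ v ≡ d
        centre {v} ∉₁ _ (inj₁ v∈) = inj₁ (decidable-stable (v ≟ c) λ v≢c → ∉₁ (v∈ , v≢c))
        centre {v} _ ∉₂ (inj₂ v∈) = inj₂ (decidable-stable (v ≟ d) λ v≢d → ∉₂ (v∈ , v≢d))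

      -- Replies to the openings $c$ and $d$

      module _ (W : Wins₂ G) where

        -- The first side already has hubs `e`, `e′` besides `c`. The reply to the opening `d`
        -- supplies hubs `f`, `f′` of the second side other than `d`; every other form of that reply
        -- leads to a forbidden split.
        twins-bridge⇒∈𝓕 : ∀ {d e e′} → U₂ d → Adj c x → Adj d x →
          e ≢ e′ → U₁ e → U₁ e′ → e ≢ c → e′ ≢ c → G ∈𝓕
        twins-bridge⇒∈𝓕 {d} d∈ cx dx e≢e′ e∈ e′∈ e≢c e′≢c with W d
        ... | _ , _ , inj₁ U = ⊥-elim (¬universal U)
        ... | d′ , d′≢d , inj₂ ψ with d′ ≟ x | Fork.e₁ ψ ≟ x | Fork.e₂ ψ ≟ x
        ...   | yes refl | _ | _ = ⊥-elim (¬twin-x-pair (≢-sym e≢c) e∈ (Fork.dom₁ ψ) (Fork.e₁≢d ψ))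
        ...   | no d′≢x | yes refl | _ =
          ⊥-elim (¬twin-x-pair (≢-sym e≢c) e∈ (DomPair-sym G (Fork.dom₁ ψ)) d′≢x)
        ...   | no d′≢x | no _ | yes refl =
          ⊥-elim (¬twin-x-pair (≢-sym e≢c) e∈ (DomPair-sym G (Fork.dom₂ ψ)) d′≢x)
        ...   | no d′≢x | no f≢x | no f′≢x
          with fork-split ψ d′≢x f≢x f′≢x | fork-x ψ d′≢x f≢x f′≢x
        ...     | inj₁ (_ , f∈ , f′∈) | _ =
          bridge⇒∈𝓕 d∈ cx dx e≢e′ e∈ e′∈ e≢c e′≢c
            (Fork.e₁≢e₂ ψ) f∈ f′∈ (Fork.e₁≢s ψ) (Fork.e₂≢s ψ)
        ...     | inj₂ (d′∈ , _ , _) | inj₁ d′x =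
          ⊥-elim (¬twins-adj₂ e≢e′ e∈ e′∈ d′≢d d′∈ d∈ d′x dx)
        ...     | inj₂ (_ , f∈ , f′∈) | inj₂ (fx , f′x) =
          ⊥-elim (¬twins₁-adj (Fork.e₁≢e₂ ψ) f∈ f′∈ fx f′x)

        c-or-partners-adj : Adj c x ⊎ (Adj w x × Adj w′ x)
        c-or-partners-adj = fork-x φ c≢x w≢x w′≢x

        -- Comparing who covers `x` in this fork and in `φ`, every case but one gives a forbidden
        -- split. In the surviving case `c` and `d` lie on different sides and are both adjacent to
        -- `x`.
        x-free-fork⇒∈𝓕 : ∀ {d} → d ≢ c → (ψ : Fork G c d) → let open Fork ψ in
          d ≢ x → e₁ ≢ x → e₂ ≢ x → G ∈𝓕
        x-free-fork⇒∈𝓕 d≢c ψ d≢x e₁≢x e₂≢x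
          with fork-split ψ d≢x e₁≢x e₂≢x | fork-x ψ d≢x e₁≢x e₂≢x | c-or-partners-adj
        ... | inj₁ (d∈ , _ , _) | inj₁ dx | inj₁ cx = ⊥-elim (¬twins₁-adj d≢c d∈ c∈U₁ dx cx)
        ... | inj₁ (d∈ , _ , _) | _ | inj₂ (wx , w′x) =
          ⊥-elim (¬twins-adj₂ d≢c d∈ c∈U₁ w≢w′ w∈U₂ w′∈U₂ wx w′x)
        ... | inj₁ (d∈ , e₁∈ , e₂∈) | inj₂ (e₁x , e₂x) | _ =
          ⊥-elim (¬twins-adj₂ d≢c d∈ c∈U₁ (Fork.e₁≢e₂ ψ) e₁∈ e₂∈ e₁x e₂x)
        ... | inj₂ (_ , e₁∈ , e₂∈) | inj₂ (e₁x , e₂x) | _ =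
          ⊥-elim (¬twins₁-adj (Fork.e₁≢e₂ ψ) e₁∈ e₂∈ e₁x e₂x)
        ... | inj₂ (_ , e₁∈ , e₂∈) | inj₁ _ | inj₂ (wx , w′x) =
          ⊥-elim (¬twins-adj₂ (Fork.e₁≢e₂ ψ) e₁∈ e₂∈ w≢w′ w∈U₂ w′∈U₂ wx w′x)
        ... | inj₂ (d∈ , e₁∈ , e₂∈) | inj₁ dx | inj₁ cx =
          twins-bridge⇒∈𝓕 d∈ cx dx (Fork.e₁≢e₂ ψ) e₁∈ e₂∈ (Fork.e₁≢s ψ) (Fork.e₂≢s ψ)

        -- One of `d` and `e` dominates the first side and is thus a twin of `c`, while `x` and `d`
        -- form a dominating pair.
        ¬fork-through-x : ∀ {d e} → d ≢ x → d ≢ c → DomPair G d x →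
          e ≢ x → e ≢ c → DomPair G d e → ⊥
        ¬fork-through-x d≢x d≢c dx e≢x e≢c de with domPair-split de d≢x e≢x
        ... | inj₁ (d∈ , _) = ¬twin-x-pair (≢-sym d≢c) d∈ (DomPair-sym G dx) d≢x
        ... | inj₂ (_ , e∈) = ¬twin-x-pair (≢-sym e≢c) e∈ (DomPair-sym G dx) d≢x

        wins⇒∈𝓕∪𝓕′ : G ∈𝓕 ⊎ G ∈𝓕′
        wins⇒∈𝓕∪𝓕′ with W c
        ... | _ , _ , inj₁ U = ⊥-elim (¬universal U)
        ... | d , d≢c , inj₂ ψ@(fork {e} {e′} e≢e′ e≢c e′≢c e≢d e′≢d de de′)
          with d ≟ x | e ≟ x | e′ ≟ x
        ...   | yes refl | _ | _ = x-fork⇒∈𝓕∪𝓕′ e≢e′ e≢d e′≢d e≢c e′≢c de de′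
        ...   | no d≢x | yes refl | _ =
          ⊥-elim (¬fork-through-x d≢x d≢c de (≢-sym e≢e′) e′≢c de′)
        ...   | no d≢x | no e≢x | yes refl = ⊥-elim (¬fork-through-x d≢x d≢c de′ e≢x e≢c de)
        ...   | no d≢x | no e≢x | no e′≢x = inj₁ (x-free-fork⇒∈𝓕 d≢c ψ d≢x e≢x e′≢x)

minimal⇒∈𝓕∪𝓕′ : ∀ {G} → Connected G → ∃ (IsCutVertex G) → Wins₂ G → Minimal G → G ∈𝓕 ⊎ G ∈𝓕′
minimal⇒∈𝓕∪𝓕′ {G} conn (x , cut) W min with W x
-- A universal vertex other than `x` would keep $G - x$ connected.
... | c , c≢x , inj₁ U = ⊥-elim (¬linked {G} {x} cut c≢x c≢x (inj₁ ∘ U) ε)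
... | c , c≢x , inj₂ φ = wins⇒∈𝓕∪𝓕′ {G} {x} cut c≢x φ conn min W

theorem2p7 : (G : Graph) → Connected G → ∃ (IsCutVertex G) →
    Is2γ′MBCritical G ⇔ (G ∈𝓕 ⊎ G ∈𝓕′)
theorem2p7 G conn cut = mk⇔
  (λ crit → minimal⇒∈𝓕∪𝓕′ conn cut (γ′MB≡2⇒Wins₂ G (proj₁ crit)) (critical⇒minimal crit))
  [ ∈𝓕⇒critical , ∈𝓕′⇒critical ]′
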